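{- Let $k\ge 2$ be an integer and let $i\in\{0,\dots,k-1\}$. For a non-negative integer $n$, let $B_{i,k}(n)$ be the number of partitions of $n$ in which each part is either even but $\not\equiv 4i+2 \pmod{4k}$, or odd and $\equiv 2i+1 \text{ or } 2k+2i+1 \pmod{4k}$. Also, let $C_{i,k}(n)$ be the number of partitions of $n$ in which the following hold: if an odd part $2j+1$ is present, then none of the other even parts are equal to any of $2j-2i+2,\, 2j-2i+4,\, \dots,\, 2j+2k-2i-2$, and none of the other odd parts are equal to any of $2j+1,\, 2j+3,\, \dots,\, 2j+2k-1$; and the smallest odd part is at least $2i+1$. Then $B_{i,k}(n) = C_{i,k}(n)$ for all $n$.
   Context: A partition of $n$ is a finite multiset of positive integers (its parts) with sum $n$; the empty partition is the only partition of $0$. "Other" parts are the remaining parts counted with multiplicity after removing one copy of $2j+1$; in particular, no odd part is repeated in a partition counted by $C_{i,k}(n)$. The lists $2j-2i+2, 2j-2i+4,\dots,2j+2k-2i-2$ and $2j+1,2j+3,\dots,2j+2k-1$ increase in steps of $2$. The condition on the smallest odd part means that every odd part is at least $2i+1$ (it is vacuous if there are no odd parts). -}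

module Defs where

open import Data.Nat using (ℕ; zero; suc; _+_; _*_; _∸_; _≤_; _<_; _≥_; z≤n; s≤s; _≟_; _≤?_; _<?_; _≥?_; ∣_-_∣)
open import Data.Nat.Properties using (≤-trans; +-mono-≤; m≤m+n; m≤n+m; *-cancelˡ-≡; +-cancelʳ-≡; +-comm; *-comm)
open import Data.Nat.Divisibility using (_∣_; _∣?_; divides)
open import Data.Nat.ListAction using (sum)
open import Data.Fin.Base using (Fin)
import Data.Fin.Properties as Fin
open import Data.List.Base using (List; []; _∷_; length; filter; lookup; removeAt; upTo; applyUpTo; cartesianProductWith)
open import Data.List.Properties using (∷-injective)
open import Data.List.Membership.Propositional using (_∈_; _∉_)
open import Data.List.Membership.DecPropositional _≟_ using (_∉?_)
open import Data.List.Membership.Propositional.Properties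
  using (∈-cartesianProductWith⁺; ∈-cartesianProductWith⁻; ∈-upTo⁺; ∈-filter⁺; ∈-filter⁻)
open import Data.List.Relation.Unary.All as All using (All; []; _∷_)
open import Data.List.Relation.Unary.AllPairs using ([]; _∷_)
open import Data.List.Relation.Unary.Any using (here; there)
open import Data.List.Relation.Unary.Linked as Linked using (Linked)
open import Data.List.Relation.Unary.Unique.Propositional using (Unique)
import Data.List.Relation.Unary.Unique.Propositional.Properties as Unique
open import Data.Product.Base using (_×_; _,_; proj₂)
open import Data.Sum.Base using (_⊎_)
open import Function.Bundles using (_⇔_; mk⇔)
open import Relation.Binary.PropositionalEquality using (_≡_; refl; sym; trans; cong)
open import Relation.Nullary.Decidable using (Dec; yes; no; ¬?; map′; _×-dec_; _⊎-dec_; _→-dec_)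
open import Relation.Nullary.Negation using (¬_; contradiction)
open import Relation.Unary using (Decidable)

-- A multiset of positive integers is represented by its unique weakly
-- decreasing listing.
IsPartition : ℕ → List ℕ → Set
IsPartition n xs = Linked _≥_ xs × All (0 <_) xs × sum xs ≡ n

isPartition? : ∀ n → Decidable (IsPartition n)
isPartition? n xs = Linked.linked? _≥?_ xs ×-dec All.all? (0 <?_) xs ×-dec (sum xs ≟ n)

-- All lists of length at most l with entries in {0, …, m}.
words : ℕ → ℕ → List (List ℕ)
words m zero    = [] ∷ []
words m (suc l) = [] ∷ cartesianProductWith _∷_ (upTo (suc m)) (words m l)

partitions : ℕ → List (List ℕ)
partitions n = filter (isPartition? n) (words n n)

∈-words : ∀ {m l xs} → All (_≤ m) xs → length xs ≤ l → xs ∈ words m l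
∈-words {l = zero}  []       z≤n     = here refl
∈-words {l = suc l} []       z≤n     = here refl
∈-words {l = suc l} (p ∷ ps) (s≤s q) =
  there (∈-cartesianProductWith⁺ _∷_ (∈-upTo⁺ (s≤s p)) (∈-words ps q))

words-unique : ∀ m l → Unique (words m l)
words-unique m zero    = [] ∷ []
words-unique m (suc l) =
  All.tabulate []≢ ∷
  Unique.cartesianProductWith⁺ _∷_ ∷-injective (Unique.upTo⁺ (suc m)) (words-unique m l)
  where
  []≢ : ∀ {ys} → ys ∈ cartesianProductWith _∷_ (upTo (suc m)) (words m l) → ¬ ([] ≡ ys)
  []≢ ys∈ refl with ∈-cartesianProductWith⁻ _∷_ (upTo (suc m)) (words m l) ys∈
  ... | _ , _ , _ , _ , ()

parts≤sum : ∀ xs → All (_≤ sum xs) xs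
parts≤sum []       = []
parts≤sum (x ∷ xs) =
  m≤m+n x (sum xs) ∷ All.map (λ p → ≤-trans p (m≤n+m (sum xs) x)) (parts≤sum xs)

length≤sum : ∀ {xs} → All (0 <_) xs → length xs ≤ sum xs
length≤sum []       = z≤n
length≤sum (p ∷ ps) = +-mono-≤ p (length≤sum ps)

∈-partitions : ∀ n xs → xs ∈ partitions n ⇔ IsPartition n xs
∈-partitions n xs = mk⇔ (λ xs∈ → proj₂ (∈-filter⁻ (isPartition? n) {xs = words n n} xs∈)) complete
  where
  complete : IsPartition n xs → xs ∈ partitions n
  complete p@(_ , pos , refl) =
    ∈-filter⁺ (isPartition? n) (∈-words (parts≤sum xs) (length≤sum pos)) p

partitions-unique : ∀ n → Unique (partitions n)
partitions-unique n = Unique.filter⁺ (isPartition? n) (words-unique n n)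

Even Odd : ℕ → Set
Even x = 2 ∣ x
Odd  x = ¬ Even x

even? : Decidable Even
even? x = 2 ∣? x

odd? : Decidable Odd
odd? x = ¬? (even? x)

infix 4 _≡_[mod_]
_≡_[mod_] : ℕ → ℕ → ℕ → Set
a ≡ b [mod m ] = m ∣ ∣ a - b ∣

BPart : (k i : ℕ) → ℕ → Set
BPart k i x =
    (Even x × ¬ (x ≡ 4 * i + 2 [mod 4 * k ]))
  ⊎ (Odd x × (x ≡ 2 * i + 1 [mod 4 * k ] ⊎ x ≡ 2 * k + 2 * i + 1 [mod 4 * k ]))

bPart? : ∀ k i → Decidable (BPart k i)
bPart? k i x =
  (even? x ×-dec ¬? (_ ∣? _)) ⊎-dec (odd? x ×-dec ((_ ∣? _) ⊎-dec (_ ∣? _)))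

-- 2j-2i+2, 2j-2i+4, …, 2j+2k-2i-2.  Truncated subtraction is harmless: a
-- negative entry becomes 0, which is never a part.
evenExcluded : (k i j : ℕ) → List ℕ
evenExcluded k i j = applyUpTo (λ t → (2 * j + 2 + 2 * t) ∸ 2 * i) (k ∸ 1)

-- 2j+1, 2j+3, …, 2j+2k-1.
oddExcluded : (k j : ℕ) → List ℕ
oddExcluded k j = applyUpTo (λ t → 2 * j + 1 + 2 * t) k

Allowed : (k i j : ℕ) → ℕ → Set
Allowed k i j y = (Even y → y ∉ evenExcluded k i j) × (Odd y → y ∉ oddExcluded k j)

allowed? : ∀ k i j → Decidable (Allowed k i j)
allowed? k i j y =
  (even? y →-dec (y ∉? evenExcluded k i j)) ×-dec (odd? y →-dec (y ∉? oddExcluded k j))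

-- Positions, not values, are quantified over, so that removeAt deletes
-- exactly one copy of 2j+1.
CPartition : (k i : ℕ) → List ℕ → Set
CPartition k i xs =
    (∀ (p : Fin (length xs)) (j : ℕ) → lookup xs p ≡ 2 * j + 1 →
       All (Allowed k i j) (removeAt xs p))
  × All (λ x → Odd x → 2 * i + 1 ≤ x) xs

private
  half-unique : ∀ {x} j j′ → x ≡ 2 * j + 1 → x ≡ 2 * j′ + 1 → j ≡ j′
  half-unique j j′ p q =
    *-cancelˡ-≡ j j′ 2 (+-cancelʳ-≡ 1 (2 * j) (2 * j′) (trans (sym p) q))

  ∀half? : ∀ {P : ℕ → Set} → Decidable P → ∀ x → Dec (∀ j → x ≡ 2 * j + 1 → P j)
  ∀half? P? zero    = yes λ j eq → contradiction (trans eq (+-comm (2 * j) 1)) λ ()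
  ∀half? {P} P? (suc x) with even? x
  ... | no ¬e = yes λ j eq →
          contradiction (divides j (trans (cong (_∸ 1) (trans eq (+-comm (2 * j) 1))) (*-comm 2 j))) ¬e
  ... | yes (divides h refl) = map′ to (λ f → f h eqh) (P? h)
    where
    eqh : suc (h * 2) ≡ 2 * h + 1
    eqh = trans (cong suc (*-comm h 2)) (+-comm 1 (2 * h))

    to : P h → ∀ j → suc (h * 2) ≡ 2 * j + 1 → P j
    to ph j eq with refl ← half-unique h j eqh eq = ph

cPartition? : ∀ k i → Decidable (CPartition k i)
cPartition? k i xs =
        Fin.all? (λ p → ∀half? (λ j → All.all? (allowed? k i j) (removeAt xs p)) (lookup xs p))
  ×-dec All.all? (λ x → odd? x →-dec (2 * i + 1 ≤? x)) xs

B : (k i n : ℕ) → ℕ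
B k i n = length (filter (All.all? (bPart? k i)) (partitions n))

C : (k i n : ℕ) → ℕ
C k i n = length (filter (cPartition? k i) (partitions n))

{-# OPTIONS --safe #-}

-- With Q = X², an odd part 2(a + i) + 1 of a partition counted by C excludes
-- exactly the even parts 2e with a < e < a + k, and two such odd parts have a's
-- at distance at least k.  Removing the largest odd part and summing over it
-- telescopes, because
--   (1 - Qᵐ) Qᵃ ∏_{a<e<a+m} (1 - Qᵉ) = ∏_{a<e≤a+m} (1 - Qᵉ) - ∏_{a≤e<a+m} (1 - Qᵉ),
-- so the partitions with r odd parts have generating function
--   X^{(2i+1)r} Q^{k r(r-1)/2} / ((1 - Qᵏ)(1 - Q²ᵏ)⋯(1 - Qʳᵏ)) · ∏_e 1 / (1 - Qᵉ).
-- On the other side, (1 - X²ᵐ) / (1 - Xᵐ) = 1 + Xᵐ turns the generating function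
-- of B into ∏_s (1 + X^{2i+1+2ks}) ∏_e 1 / (1 - Qᵉ), which satisfies the same
-- recurrence with (Q, k) replaced by (Qᵏ, 1).  The limit only depends on Qᵏ.
module Submission where

open import Defs
open import Data.Bool.Base as Bool using (true; false)
open import Data.Fin.Base as Fin using (Fin)
open import Data.Integer.Base as ℤ using (ℤ; 0ℤ; +_)
import Data.Integer.Properties as ℤ
import Data.Integer.Tactic.RingSolver as ℤ-Ring
open import Algebra.Properties.AbelianGroup ℤ.+-0-abelianGroup
  using (∙-cancelʳ; //-rightDividesˡ; //-rightDividesʳ)
open import Data.List.Base
  using (List; []; _∷_; _++_; length; filter; map; lookup; removeAt; applyDownFrom)
open import Data.List.Properties using (length-map; ∷-injectiveˡ; ∷-injectiveʳ)
open import Data.List.Membership.Propositional using (_∈_; _∉_)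
open import Data.List.Membership.Propositional.Properties
open import Data.List.Membership.Propositional.Properties.WithK using (unique∧set⇒bag)
open import Data.List.Relation.Binary.BagAndSetEquality using (∼bag⇒↭)
open import Data.List.Relation.Binary.Permutation.Propositional
  using (_↭_; ↭-sym; ↭-trans; prep; ↭⇒↭ₛ)
open import Data.List.Relation.Binary.Permutation.Propositional.Properties
  using (↭-length; All-resp-↭; ∈-resp-↭)
  renaming (shift to ↭-shift)
open import Data.List.Relation.Binary.Pointwise using (Pointwise-≡⇒≡)
open import Data.List.Relation.Unary.All as All using (All; []; _∷_)
open import Data.List.Relation.Unary.All.Properties using (¬Any⇒All¬; All¬⇒¬Any)
open import Data.List.Relation.Unary.AllPairs using (AllPairs; []; _∷_; allPairs?)
open import Data.List.Relation.Unary.Any as Any using (here; there)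
open import Data.List.Relation.Unary.Any.Properties using (lookup-index)
open import Data.List.Relation.Unary.Sorted.TotalOrder.Properties using (↗↭↗⇒≋)
open import Data.List.Relation.Unary.Unique.Propositional using (Unique)
import Data.List.Relation.Unary.Unique.Propositional.Properties as Unique
open import Data.Nat
  using (ℕ; zero; suc; _+_; _*_; _∸_; _≤_; _<_; z≤n; s≤s; z<s; _≤?_; _<?_; _≟_; _≤ᵇ_; ⌊_/2⌋;
         NonZero; >-nonZero)
open import Data.Nat.Divisibility using (_∣_; divides; m∣m*n; >⇒∤)
open import Data.Nat.ListAction using (sum)
open import Data.Nat.ListAction.Properties using (sum-↭)
open import Data.Nat.Properties
import Data.Nat.Tactic.RingSolver as ℕ-Ring
open import Data.List.Membership.DecPropositional _≟_ using (_∈?_; _∉?_)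
open import Data.Product.Base using (_×_; _,_; proj₁; proj₂; ∃-syntax; swap; map₂)
open import Data.Sum.Base using (_⊎_; inj₁; inj₂)
open import Function.Base using (_∘_; id)
open import Function.Bundles using (_⇔_; mk⇔; Equivalence)
open import Relation.Binary.Bundles using (DecTotalOrder)
import Relation.Binary.Construct.Flip.EqAndOrd as Flip
open import Relation.Binary.Definitions using () renaming (Decidable to Decidable₂)
open import Relation.Binary.PropositionalEquality
open import Data.List.Relation.Binary.Permutation.Setoid.Properties (setoid ℕ) using (AllPairs-resp-↭)
open import Relation.Nullary.Decidable
  using (yes; no; ¬?; _×-dec_; _⊎-dec_; _→-dec_; decidable-stable)
open import Relation.Nullary.Negation using (¬_; contradiction)
open import Relation.Unary using (Decidable)

open Equivalence using (to; from)

-- Power series over ℤ and multiplication by X^e and 1 - X^e.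

Series : Set
Series = ℕ → ℤ

infixl 6 _⊕_ _⊖_
_⊕_ _⊖_ : Series → Series → Series
(f ⊕ g) n = f n ℤ.+ g n
(f ⊖ g) n = f n ℤ.- g n

0s : Series
0s _ = 0ℤ

delay : Series → Series
delay f zero    = 0ℤ
delay f (suc n) = f n

-- Multiplication by X^e and by 1 - X^e.
shift Δ : ℕ → Series → Series
shift zero    f = f
shift (suc e) f = delay (shift e f)
Δ e f = f ⊖ shift e f

delay-cong : ∀ {f g} → f ≗ g → delay f ≗ delay g
delay-cong eq zero    = refl
delay-cong eq (suc n) = eq n

-- These are the multiplications by a fixed series, so they commute with every Δ e.
record Linear (φ : Series → Series) : Set where
  field
    φ-cong  : ∀ {f g} → f ≗ g → φ f ≗ φ g
    φ-⊕     : ∀ f g → φ (f ⊕ g) ≗ φ f ⊕ φ g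
    φ-delay : ∀ f → φ (delay f) ≗ delay (φ f)

  φ-shift : ∀ e f → φ (shift e f) ≗ shift e (φ f)
  φ-shift zero    f n = refl
  φ-shift (suc e) f n = trans (φ-delay (shift e f) n) (delay-cong (φ-shift e f) n)

  φ-⊖ : ∀ f g → φ (f ⊖ g) ≗ φ f ⊖ φ g
  φ-⊖ f g n = begin
    φ (f ⊖ g) n                           ≡⟨ //-rightDividesʳ (φ g n) (φ (f ⊖ g) n) ⟨
    φ (f ⊖ g) n ℤ.+ φ g n ℤ.- φ g n       ≡⟨ cong (ℤ._- φ g n) (φ-⊕ (f ⊖ g) g n) ⟨
    φ (f ⊖ g ⊕ g) n ℤ.- φ g n             ≡⟨ cong (ℤ._- φ g n) (φ-cong (λ m → //-rightDividesˡ (g m) (f m)) n) ⟩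
    φ f n ℤ.- φ g n                       ∎
    where
    open ≡-Reasoning

  φ-Δ : ∀ e f → φ (Δ e f) ≗ Δ e (φ f)
  φ-Δ e f n = trans (φ-⊖ f (shift e f) n) (cong (λ z → φ f n ℤ.- z) (φ-shift e f n))

  φ-0 : ∀ {f} → f ≗ 0s → φ f ≗ 0s
  φ-0 {f} f≗0 n = begin
    φ f n                   ≡⟨ φ-cong (λ m → trans (f≗0 m) (sym (cong₂ ℤ._-_ (f≗0 m) (f≗0 m)))) n ⟩
    φ (f ⊖ f) n             ≡⟨ φ-⊖ f f n ⟩
    φ f n ℤ.- φ f n         ≡⟨ ℤ.+-inverseʳ (φ f n) ⟩
    0ℤ                      ∎
    where open ≡-Reasoning

open Linear

id-linear : Linear id
id-linear .φ-cong eq   = eq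
id-linear .φ-⊕ f g n   = refl
id-linear .φ-delay f n = refl

∘-linear : ∀ {φ ψ} → Linear φ → Linear ψ → Linear (φ ∘ ψ)
∘-linear L K .φ-cong eq   = φ-cong L (φ-cong K eq)
∘-linear L K .φ-⊕ f g n   = trans (φ-cong L (φ-⊕ K f g) n) (φ-⊕ L _ _ n)
∘-linear L K .φ-delay f n = trans (φ-cong L (φ-delay K f) n) (φ-delay L _ n)

delay-linear : Linear delay
delay-linear .φ-cong         = delay-cong
delay-linear .φ-⊕ f g zero    = refl
delay-linear .φ-⊕ f g (suc n) = refl
delay-linear .φ-delay f n     = refl

shift-linear : ∀ e → Linear (shift e)
shift-linear zero    = id-linear
shift-linear (suc e) = ∘-linear delay-linear (shift-linear e)

Δ-linear : ∀ e → Linear (Δ e)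
Δ-linear e .φ-cong eq n = cong₂ ℤ._-_ (eq n) (φ-cong (shift-linear e) eq n)
Δ-linear e .φ-⊕ f g n =
  trans (cong (λ z → f n ℤ.+ g n ℤ.- z) (φ-⊕ (shift-linear e) f g n))
        (regroup (f n) (g n) _ _)
  where
  regroup : ∀ a b x y → a ℤ.+ b ℤ.- (x ℤ.+ y) ≡ (a ℤ.- x) ℤ.+ (b ℤ.- y)
  regroup = ℤ-Ring.solve-∀
Δ-linear e .φ-delay f n =
  trans (cong (λ z → delay f n ℤ.- z) (φ-delay (shift-linear e) f n))
        (sym (φ-⊖ delay-linear f (shift e f) n))

shift-+ : ∀ a b f → shift a (shift b f) ≡ shift (a + b) f
shift-+ zero    b f = refl
shift-+ (suc a) b f = cong delay (shift-+ a b f)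

shift-< : ∀ {n} e f → n < e → shift e f n ≡ 0ℤ
shift-< {zero}  (suc e) f _         = refl
shift-< {suc n} (suc e) f (s≤s n<e) = shift-< e f n<e

shift-at : ∀ e f n → shift e f (e + n) ≡ f n
shift-at zero    f n = refl
shift-at (suc e) f n = shift-at e f n

Δ-< : ∀ {n} e f → n < e → Δ e f n ≡ f n
Δ-< {n} e f n<e = trans (cong (λ z → f n ℤ.- z) (shift-< e f n<e)) (ℤ.+-identityʳ (f n))

m<o∸n⇒m+n<o : ∀ {m n o} → m < o ∸ n → m + n < o
m<o∸n⇒m+n<o {m} {n} {o} m< =
  subst (m + n <_) (m∸n+n≡m (<⇒≤ (m∸n≢0⇒n<m {o} {n} λ o∸n≡0 → n≮0 (subst (m <_) o∸n≡0 m<))))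
    (+-monoˡ-< n m<)

infix 4 _≈⟨_⟩_
_≈⟨_⟩_ : Series → ℕ → Series → Set
f ≈⟨ n ⟩ g = ∀ m → m ≤ n → f m ≡ g m

shift-≈ : ∀ {f g n} e → f ≈⟨ n ⟩ g → shift e f ≈⟨ n ⟩ shift e g
shift-≈ zero    eq m       m≤n = eq m m≤n
shift-≈ (suc e) eq zero    m≤n = refl
shift-≈ (suc e) eq (suc m) m≤n = shift-≈ e eq m (<⇒≤ m≤n)

-- For e > 0 the factor 1 - X^e has constant term 1, so the coefficients of `f` are recovered from
-- low to high: each is determined by one of `Δ e f` and an earlier one of `f`.
Δ-cancel : ∀ {f g n} e → .{{NonZero e}} → Δ e f ≈⟨ n ⟩ Δ e g → f ≈⟨ n ⟩ g
Δ-cancel {f} {g} {n} (suc e) eq m m≤n = agree m m≤n m ≤-refl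
  where
  drop : ∀ {x y} z → x ℤ.- z ≡ y ℤ.- z → x ≡ y
  drop z = ∙-cancelʳ (ℤ.- z) _ _
  agree : ∀ b → b ≤ n → f ≈⟨ b ⟩ g
  agree zero b≤n zero _ = drop 0ℤ (eq 0 z≤n)
  agree (suc b) b≤n m m≤1+b with m≤n⇒m<n∨m≡n m≤1+b
  ... | inj₁ (s≤s m≤b) = agree b (<⇒≤ b≤n) m m≤b
  -- The shift is by `suc e`, so its coefficient at `suc b` is that of `shift e` at `b`, where
  -- agreement is already known.
  ... | inj₂ refl = drop (shift e f b) (trans (eq (suc b) b≤n)
          (cong (λ z → g (suc b) ℤ.- z) (sym (shift-≈ e (agree b (<⇒≤ b≤n)) b ≤-refl))))

-- Finite sums of series and the products (1 - X^q)⋯(1 - X^(rq)).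

Σs : ℕ → (ℕ → Series) → Series
Σs zero    F = 0s
Σs (suc m) F = Σs m F ⊕ F m

Σs-cong : ∀ {F G} m {n} → (∀ {a} → a < m → F a n ≡ G a n) → Σs m F n ≡ Σs m G n
Σs-cong zero    eq = refl
Σs-cong (suc m) eq = cong₂ ℤ._+_ (Σs-cong m (eq ∘ m<n⇒m<1+n)) (eq ≤-refl)

Σs-0 : ∀ {F} m → (∀ {a} → a < m → F a ≗ 0s) → Σs m F ≗ 0s
Σs-0 zero    eq n = refl
Σs-0 (suc m) eq n = cong₂ ℤ._+_ (Σs-0 m (eq ∘ m<n⇒m<1+n) n) (eq ≤-refl n)

Σs-head : ∀ F m → Σs (suc m) F ≗ F 0 ⊕ Σs m (F ∘ suc)
Σs-head F zero    n = ℤ.+-comm 0ℤ (F 0 n)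
Σs-head F (suc m) n = trans (cong (ℤ._+ F (suc m) n) (Σs-head F m n)) (ℤ.+-assoc (F 0 n) _ _)

Σs-linear : ∀ {φ} → Linear φ → ∀ F m → φ (Σs m F) ≗ Σs m (φ ∘ F)
Σs-linear L F zero    n = φ-0 L (λ _ → refl) n
Σs-linear {φ} L F (suc m) n =
  trans (φ-⊕ L (Σs m F) (F m) n) (cong (ℤ._+ φ (F m) n) (Σs-linear L F m n))

Σs-swap : ∀ (G : ℕ → ℕ → Series) l m →
          Σs l (λ a → Σs m (G a)) ≗ Σs m (λ r → Σs l (λ a → G a r))
Σs-swap G zero    m n = sym (Σs-0 m (λ _ _ → refl) n)
Σs-swap G (suc l) m n = trans (cong (ℤ._+ Σs m (G l) n) (Σs-swap G l m n)) (sym (Σs-⊕ m))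
  where
  interchange : ∀ a b c d → a ℤ.+ b ℤ.+ (c ℤ.+ d) ≡ a ℤ.+ c ℤ.+ (b ℤ.+ d)
  interchange = ℤ-Ring.solve-∀
  Σs-⊕ : ∀ m → Σs m (λ r → Σs (suc l) (λ a → G a r)) n
             ≡ Σs m (λ r → Σs l (λ a → G a r)) n ℤ.+ Σs m (G l) n
  Σs-⊕ zero    = refl
  Σs-⊕ (suc m) = trans (cong (ℤ._+ Σs (suc l) (λ a → G a m) n) (Σs-⊕ m))
    (interchange (Σs m (λ r → Σs l (λ a → G a r)) n) (Σs m (G l) n) (Σs l (λ a → G a m) n) (G l m n))

-- r(r - 1)/2, the least sum of r distinct natural numbers; times `k`, the least sum of r values `a`
-- at mutual distance at least `k`.
tri : ℕ → ℕ
tri zero    = 0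
tri (suc r) = tri r + r

-- Multiplication by (1 - X^q)(1 - X^2q)⋯(1 - X^rq).
Δs : ℕ → ℕ → Series → Series
Δs q zero    f = f
Δs q (suc r) f = Δ (suc r * q) (Δs q r f)

Δs-linear : ∀ q r → Linear (Δs q r)
Δs-linear q zero    = id-linear
Δs-linear q (suc r) = ∘-linear (Δ-linear (suc r * q)) (Δs-linear q r)

φ-Δs : ∀ {φ} → Linear φ → ∀ q r f → φ (Δs q r f) ≗ Δs q r (φ f)
φ-Δs L q zero    f n = refl
φ-Δs L q (suc r) f n =
  trans (φ-Δ L (suc r * q) (Δs q r f) n) (φ-cong (Δ-linear (suc r * q)) (φ-Δs L q r f) n)

Δs-cancel : ∀ {f g n} q → .{{NonZero q}} → ∀ r → Δs q r f ≈⟨ n ⟩ Δs q r g → f ≈⟨ n ⟩ g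
Δs-cancel q           zero    eq = eq
-- Matching `q` as a successor lets `suc r * q` reduce to a successor, which supplies the `NonZero`
-- instance.
Δs-cancel q@(suc _) (suc r) eq = Δs-cancel q r (Δ-cancel (suc r * q) eq)

-- The telescoping identity without its common factors: both sides are X^a - X^(a+b).
telescope : ∀ a b f → Δ b (shift a f) ≗ Δ (b + a) f ⊖ Δ a f
telescope a b f n =
  trans (cong (λ g → shift a f n ℤ.- g n) (shift-+ b a f)) (rearrange (f n) _ _)
  where
  rearrange : ∀ x y z → y ℤ.- z ≡ (x ℤ.- z) ℤ.- (x ℤ.- y)
  rearrange = ℤ-Ring.solve-∀

-- The recurrence on the largest odd part, in the variable Q = X^c with gap k.

module Recurrence (c k′ : ℕ) (p : Series) where

  private
    k = suc k′

  -- Multiplication by the product of 1 - Q^e over d < e ≤ d + ℓ.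
  block : ℕ → ℕ → Series → Series
  block d zero    f = f
  block d (suc ℓ) f = Δ (c * (d + suc ℓ)) (block d ℓ f)

  block-linear : ∀ d ℓ → Linear (block d ℓ)
  block-linear d zero    = id-linear
  block-linear d (suc ℓ) = ∘-linear (Δ-linear (c * (d + suc ℓ))) (block-linear d ℓ)

  block-++ : ∀ d ℓ m f → block (d + ℓ) m (block d ℓ f) ≗ block d (ℓ + m) f
  block-++ d ℓ zero    f n rewrite +-identityʳ ℓ = refl
  block-++ d ℓ (suc m) f n rewrite +-suc ℓ m | +-assoc d ℓ (suc m) | +-suc ℓ m =
    φ-cong (Δ-linear (c * (d + suc (ℓ + m)))) (block-++ d ℓ m f) n

  -- `block` grows at its upper end; the telescoping also has to extend a window from d + 1 down to
  -- d.
  block-bottom : ∀ d ℓ f → Δ (c * suc d) (block (suc d) ℓ f) ≗ block d (suc ℓ) f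
  block-bottom d zero    f n rewrite +-comm d 1 = refl
  block-bottom d (suc ℓ) f n rewrite +-suc d (suc ℓ) = begin
    Δ (c * suc d) (Δ e (block (suc d) ℓ f)) n   ≡⟨ φ-Δ (Δ-linear (c * suc d)) e (block (suc d) ℓ f) n ⟩
    Δ e (Δ (c * suc d) (block (suc d) ℓ f)) n   ≡⟨ φ-cong (Δ-linear e) (block-bottom d ℓ f) n ⟩
    Δ e (block d (suc ℓ) f) n                   ∎
    where
    open ≡-Reasoning
    e = c * suc (d + suc ℓ)

  -- Every exponent in the product exceeds d ≥ n, so no factor affects the coefficients up to n.
  block-≈ : .{{NonZero c}} → ∀ {n} d ℓ f → n ≤ d → block d ℓ f ≈⟨ n ⟩ f
  block-≈ d zero    f n≤d m m≤n = refl
  block-≈ d (suc ℓ) f n≤d m m≤n =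
    trans (Δ-< (c * (d + suc ℓ)) (block d ℓ f) m<e) (block-≈ d ℓ f n≤d m m≤n)
    where
    m<e : m < c * (d + suc ℓ)
    m<e = ≤-trans (s≤s (≤-trans m≤n (≤-trans n≤d (m≤m+n d ℓ))))
            (≤-trans (≤-reflexive (sym (+-suc d ℓ))) (m≤n*m (d + suc ℓ) c))

  -- Multiplication by X^(c a) (1 - X^(c (a+1))) ⋯ (1 - X^(c (a+k-1))).
  step : ℕ → Series → Series
  step a f = shift (c * a) (block a k′ f)

  step-linear : ∀ a → Linear (step a)
  step-linear a = ∘-linear (shift-linear (c * a)) (block-linear a k′)

  -- The sum is over the a with a + k ≤ M.
  graded : ℕ → ℕ → Series
  graded zero    M = p
  graded (suc r) M = Σs (M ∸ k′) (λ a → step a (graded r a))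

  -- Each of the r nested choices takes up k units of the range, so a range shorter than rk admits
  -- none. This is where the telescoping sum starts.
  graded-vanish : ∀ r M → M < r * k → graded r M ≗ 0s
  graded-vanish (suc r) M M< = Σs-0 (M ∸ k′) λ {a} a< →
    φ-0 (step-linear a) (graded-vanish r a (bound a<))
    where
    bound : ∀ {a} → a < M ∸ k′ → a < r * k
    bound {a} a< = +-cancelʳ-< k′ a (r * k) (≤-trans (m<o∸n⇒m+n<o a<)
                     (≤-trans (≤-pred M<) (≤-reflexive (+-comm k′ (r * k)))))

  -- The inner induction on d telescopes.
  graded-closed : ∀ r d → Δs (c * k) r (graded r (d + r * k))
                        ≗ shift (tri r * (c * k)) (block d (r * k) p)
  graded-closed zero    d n = refl
  graded-closed (suc r) d n = begin
    Δs q (suc r) (graded (suc r) (d + suc r * k)) n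
      ≡⟨ cong (λ m → Δs q (suc r) (Σs m F) n) (range d) ⟩
    Δs q (suc r) (Σs (suc (d + r * k)) F) n
      ≡⟨ partial d n ⟩
    shift T (block d (suc ℓ) p) n
      ≡⟨ cong (λ m → shift T (block d (suc m) p) n) (+-comm (r * k) k′) ⟩
    shift T (block d (suc r * k) p) n
      ∎
    where
    open ≡-Reasoning
    q = c * k
    T = tri (suc r) * q
    ℓ = r * k + k′
    F : ℕ → Series
    F a = step a (graded r a)

    range : ∀ d → d + suc r * k ∸ k′ ≡ suc (d + r * k)
    range d = trans (cong (_∸ k′) (solve d k′ (r * k))) (m+n∸n≡m _ k′)
      where
      solve : ∀ d x y → d + suc (x + y) ≡ suc (d + y) + x
      solve = ℕ-Ring.solve-∀

    G : ℕ → Series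
    G d = block d ℓ p

    exponent : ∀ d → c * (d + r * k) + tri r * q ≡ T + c * d
    exponent d = solve c d (tri r) r k
      where
      solve : ∀ c d t r k → c * (d + r * k) + t * (c * k) ≡ (t + r) * (c * k) + c * d
      solve = ℕ-Ring.solve-∀

    -- Up to X^T, the summand at a = d + rk becomes (1 - X^((r+1)q)) X^(cd) times a block.
    -- `telescope` makes it a difference: one term extends the block upwards, the other downwards.
    increment : ∀ d → Δs q (suc r) (F (d + r * k))
                    ≗ shift T (block d (suc ℓ) p) ⊖ shift T (Δ (c * d) (G d))
    increment d n = begin
      Δ (suc r * q) (Δs q r (step a (graded r a))) n
        ≡⟨ φ-cong (Δ-linear (suc r * q)) merge n ⟩
      Δ (suc r * q) (shift T (shift (c * d) (G d))) n
        ≡⟨ φ-Δ (shift-linear T) (suc r * q) (shift (c * d) (G d)) n ⟨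
      shift T (Δ (suc r * q) (shift (c * d) (G d))) n
        ≡⟨ φ-cong (shift-linear T) (telescope (c * d) (suc r * q) (G d)) n ⟩
      shift T (Δ (suc r * q + c * d) (G d) ⊖ Δ (c * d) (G d)) n
        ≡⟨ φ-⊖ (shift-linear T) (Δ (suc r * q + c * d) (G d)) (Δ (c * d) (G d)) n ⟩
      shift T (Δ (suc r * q + c * d) (G d)) n ℤ.- shift T (Δ (c * d) (G d)) n
        ≡⟨ cong (λ e → shift T (Δ e (G d)) n ℤ.- shift T (Δ (c * d) (G d)) n) (top c d r k′) ⟩
      shift T (block d (suc ℓ) p) n ℤ.- shift T (Δ (c * d) (G d)) n
        ∎
      where
      a = d + r * k

      top : ∀ c d r j → suc r * (c * suc j) + c * d ≡ c * (d + suc (r * suc j + j))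
      top = ℕ-Ring.solve-∀

      -- The factors of `step a` begin just above a = d + rk, where the product in the closed form
      -- for r ends, so the two fuse into one block of length ℓ.
      merge : Δs q r (step a (graded r a)) ≗ shift T (shift (c * d) (G d))
      merge m = begin
        Δs q r (step a (graded r a)) m
          ≡⟨ φ-Δs (step-linear a) q r (graded r a) m ⟨
        step a (Δs q r (graded r a)) m
          ≡⟨ φ-cong (step-linear a) (graded-closed r d) m ⟩
        step a (shift (tri r * q) (block d (r * k) p)) m
          ≡⟨ φ-cong (shift-linear (c * a)) (φ-shift (block-linear a k′) (tri r * q) _) m ⟩
        shift (c * a) (shift (tri r * q) (block a k′ (block d (r * k) p))) m
          ≡⟨ cong (λ f → f m) (shift-+ (c * a) (tri r * q) _) ⟩
        shift (c * a + tri r * q) (block a k′ (block d (r * k) p)) m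
          ≡⟨ φ-cong (shift-linear (c * a + tri r * q)) (block-++ d (r * k) k′ p) m ⟩
        shift (c * a + tri r * q) (G d) m
          ≡⟨ cong (λ e → shift e (G d) m) (exponent d) ⟩
        shift (T + c * d) (G d) m
          ≡⟨ cong (λ f → f m) (shift-+ T (c * d) (G d)) ⟨
        shift T (shift (c * d) (G d)) m
          ∎

    -- The subtracted term of the increment at d is the value of the sum of all earlier terms, so
    -- adding the increment leaves its other term, as `partial` says. `lower` at d + 1 is `partial`
    -- at d, rewritten by `block-bottom`.
    lower : ∀ d → Δs q (suc r) (Σs (d + r * k) F) ≗ shift T (Δ (c * d) (G d))
    partial : ∀ d → Δs q (suc r) (Σs (suc (d + r * k)) F) ≗ shift T (block d (suc ℓ) p)

    -- All terms with a < rk vanish, and on the right 1 - X^0 = 0.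
    lower zero n = begin
      Δs q (suc r) (Σs (r * k) F) n
        ≡⟨ φ-0 (Δs-linear q (suc r)) (Σs-0 (r * k) λ {a} a< →
             φ-0 (step-linear a) (graded-vanish r a a<)) n ⟩
      0ℤ
        ≡⟨ φ-0 (shift-linear T) (λ m → trans (cong (λ e → Δ e (G 0) m) (*-zeroʳ c))
             (ℤ.+-inverseʳ (G 0 m))) n ⟨
      shift T (Δ (c * 0) (G 0)) n
        ∎
    lower (suc d) n =
      trans (partial d n) (sym (φ-cong (shift-linear T) (block-bottom d ℓ p) n))

    partial d n = begin
      Δs q (suc r) (Σs (d + r * k) F ⊕ F (d + r * k)) n
        ≡⟨ φ-⊕ (Δs-linear q (suc r)) (Σs (d + r * k) F) (F (d + r * k)) n ⟩
      Δs q (suc r) (Σs (d + r * k) F) n ℤ.+ Δs q (suc r) (F (d + r * k)) n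
        ≡⟨ cong₂ ℤ._+_ (lower d n) (increment d n) ⟩
      shift T (Δ (c * d) (G d)) n
        ℤ.+ (shift T (block d (suc ℓ) p) n ℤ.- shift T (Δ (c * d) (G d)) n)
        ≡⟨ restore (shift T (Δ (c * d) (G d)) n) _ ⟩
      shift T (block d (suc ℓ) p) n
        ∎
      where
      restore : ∀ x y → x ℤ.+ (y ℤ.- x) ≡ y
      restore = ℤ-Ring.solve-∀

  -- With M = d + rk and d ≥ n, the remaining block lies beyond degree n. What is left depends on c
  -- and k only through ck, which makes the two sides comparable.
  graded-limit : .{{NonZero c}} → ∀ {n M} r → n + r * k ≤ M →
                 Δs (c * k) r (graded r M) ≈⟨ n ⟩ shift (tri r * (c * k)) p
  graded-limit {n} {M} r n+rk≤M m m≤n = begin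
    Δs (c * k) r (graded r M) m
      ≡⟨ cong (λ x → Δs (c * k) r (graded r x) m) (m∸n+n≡m (m+n≤o⇒n≤o n n+rk≤M)) ⟨
    Δs (c * k) r (graded r (d + r * k)) m
      ≡⟨ graded-closed r d m ⟩
    shift (tri r * (c * k)) (block d (r * k) p) m
      ≡⟨ shift-≈ (tri r * (c * k)) (block-≈ d (r * k) p (m+n≤o⇒m≤o∸n n n+rk≤M)) m m≤n ⟩
    shift (tri r * (c * k)) p m
      ∎
    where
    open ≡-Reasoning
    d = M ∸ r * k

  -- `V M` stands for the count in which every odd part has an index a with a + k ≤ M. The recursion
  -- separates the case of a largest odd part of index a: its weight is X^w Q^a, and the block in
  -- `step a` removes the even parts it excludes.
  record Solution (w : ℕ) (V : ℕ → Series) : Set where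
    field
      initial   : ∀ {M} → M ≤ k′ → V M ≗ p
      recursive : ∀ a → V (suc a + k′) ≗ V (a + k′) ⊕ shift w (step a (V a))

  module _ {w V} (S : Solution w V) where
    open Solution S

    unfold : ∀ M → V M ≗ p ⊕ Σs (M ∸ k′) (λ a → shift w (step a (V a)))
    unfold M n with M ≤? k′
    ... | yes M≤k′ rewrite m≤n⇒m∸n≡0 M≤k′ = trans (initial M≤k′ n) (sym (ℤ.+-identityʳ (p n)))
    ... | no M≰k′ = begin
      V M n                     ≡⟨ cong (λ x → V x n) M≡ ⟨
      V (M ∸ k′ + k′) n         ≡⟨ go (M ∸ k′) n ⟩
      p n ℤ.+ Σs (M ∸ k′) _ n   ∎
      where
      open ≡-Reasoning
      M≡ : M ∸ k′ + k′ ≡ M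
      M≡ = m∸n+n≡m (<⇒≤ (≰⇒> M≰k′))
      go : ∀ x → V (x + k′) ≗ p ⊕ Σs x (λ a → shift w (step a (V a)))
      go zero    n = trans (initial ≤-refl n) (sym (ℤ.+-identityʳ (p n)))
      go (suc x) n = trans (recursive x n)
        (trans (cong (ℤ._+ shift w (step x (V x)) n) (go x n)) (ℤ.+-assoc (p n) _ _))

    -- Iterating `unfold` sorts by the number r of odd parts. Each choice strictly lowers the bound
    -- M, so any R > M is enough fuel for the induction.
    expand : ∀ R {M} → M < R → V M ≗ Σs R (λ r → shift (r * w) (graded r M))
    expand (suc R) {M} (s≤s M≤R) n = begin
      V M n
        ≡⟨ unfold M n ⟩
      p n ℤ.+ Σs (M ∸ k′) (λ a → shift w (step a (V a))) n
        ≡⟨ cong (λ z → p n ℤ.+ z) (Σs-cong (M ∸ k′) λ {a} a< → trans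
             (φ-cong (L a) (expand R (<-≤-trans a< (≤-trans (m∸n≤m M k′) M≤R))) n)
             (Σs-linear (L a) _ R n)) ⟩
      p n ℤ.+ Σs (M ∸ k′) (λ a → Σs R (λ r → shift w (step a (shift (r * w) (graded r a))))) n
        ≡⟨ cong (λ z → p n ℤ.+ z) (Σs-swap _ (M ∸ k′) R n) ⟩
      p n ℤ.+ Σs R (λ r → Σs (M ∸ k′) (λ a → shift w (step a (shift (r * w) (graded r a))))) n
        ≡⟨ cong (λ z → p n ℤ.+ z) (Σs-cong R λ {r} _ → gather r) ⟩
      p n ℤ.+ Σs R (λ r → shift (suc r * w) (graded (suc r) M)) n
        ≡⟨ Σs-head (λ r → shift (r * w) (graded r M)) R n ⟨
      Σs (suc R) (λ r → shift (r * w) (graded r M)) n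
        ∎
      where
      open ≡-Reasoning
      L : ∀ a → Linear (shift w ∘ step a)
      L a = ∘-linear (shift-linear w) (step-linear a)

      gather : ∀ r → Σs (M ∸ k′) (λ a → shift w (step a (shift (r * w) (graded r a)))) n
                   ≡ shift (suc r * w) (graded (suc r) M) n
      gather r = begin
        Σs (M ∸ k′) (λ a → shift w (step a (shift (r * w) (graded r a)))) n
          ≡⟨ Σs-cong (M ∸ k′) (λ {a} _ → trans
               (φ-cong (shift-linear w) (φ-shift (step-linear a) (r * w) (graded r a)) n)
               (cong (λ f → f n) (shift-+ w (r * w) _))) ⟩
        Σs (M ∸ k′) (λ a → shift (suc r * w) (step a (graded r a))) n
          ≡⟨ Σs-linear (shift-linear (suc r * w)) _ (M ∸ k′) n ⟨
        shift (suc r * w) (graded (suc r) M) n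
          ∎

-- The expansions are compared term by term. For r ≤ n both terms have the same limit up to degree n
-- after multiplication by the same product, which can be cancelled. For r > n the factor X^(rw)
-- with w > 0 pushes both past degree n.
limit-unique :
  ∀ {c₁ k₁ c₂ k₂ p w V₁ V₂} .{{_ : NonZero c₁}} .{{_ : NonZero c₂}} .{{_ : NonZero w}} →
  c₁ * suc k₁ ≡ c₂ * suc k₂ →
  Recurrence.Solution c₁ k₁ p w V₁ → Recurrence.Solution c₂ k₂ p w V₂ →
  ∀ {n M₁ M₂} → n + n * suc k₁ ≤ M₁ → n + n * suc k₂ ≤ M₂ → V₁ M₁ n ≡ V₂ M₂ n
limit-unique {c₁} {k₁} {c₂} {k₂} {p} {w} {V₁} {V₂} c₁k₁≡c₂k₂ S₁ S₂ {n} {M₁} {M₂} n≤M₁ n≤M₂ = begin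
  V₁ M₁ n                                           ≡⟨ R₁.expand S₁ R (s≤s (m≤m+n M₁ M₂)) n ⟩
  Σs R (λ r → shift (r * w) (R₁.graded r M₁)) n     ≡⟨ Σs-cong R (λ {r} _ → term r) ⟩
  Σs R (λ r → shift (r * w) (R₂.graded r M₂)) n     ≡⟨ R₂.expand S₂ R (s≤s (m≤n+m M₂ M₁)) n ⟨
  V₂ M₂ n                                           ∎
  where
  open ≡-Reasoning
  module R₁ = Recurrence c₁ k₁ p
  module R₂ = Recurrence c₂ k₂ p
  R = suc (M₁ + M₂)

  instance
    q≢0 : NonZero (c₂ * suc k₂)
    q≢0 = m*n≢0 c₂ (suc k₂)

  limit₁ : ∀ r → r ≤ n → Δs (c₂ * suc k₂) r (R₁.graded r M₁) ≈⟨ n ⟩ shift (tri r * (c₂ * suc k₂)) p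
  limit₁ r r≤n = subst (λ q → Δs q r (R₁.graded r M₁) ≈⟨ n ⟩ shift (tri r * q) p) c₁k₁≡c₂k₂
    (R₁.graded-limit r (≤-trans (+-monoʳ-≤ n (*-monoˡ-≤ (suc k₁) r≤n)) n≤M₁))

  limit₂ : ∀ r → r ≤ n → Δs (c₂ * suc k₂) r (R₂.graded r M₂) ≈⟨ n ⟩ shift (tri r * (c₂ * suc k₂)) p
  limit₂ r r≤n = R₂.graded-limit r (≤-trans (+-monoʳ-≤ n (*-monoˡ-≤ (suc k₂) r≤n)) n≤M₂)

  term : ∀ r → shift (r * w) (R₁.graded r M₁) n ≡ shift (r * w) (R₂.graded r M₂) n
  term r with r ≤? n
  ... | yes r≤n = shift-≈ (r * w) (Δs-cancel (c₂ * suc k₂) r λ m m≤n →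
          trans (limit₁ r r≤n m m≤n) (sym (limit₂ r r≤n m m≤n))) n ≤-refl
  ... | no r≰n = trans (shift-< (r * w) _ n<rw) (sym (shift-< (r * w) _ n<rw))
    where
    n<rw : n < r * w
    n<rw = <-≤-trans (≰⇒> r≰n) (m≤m*n r w)

-- Multisets as decreasing lists, and insertion of a part.

≥-decTotalOrder : DecTotalOrder _ _ _
≥-decTotalOrder = Flip.decTotalOrder ≤-decTotalOrder

open import Data.List.Sort.InsertionSort.Base ≥-decTotalOrder using (insert; sort)
open import Data.List.Sort.InsertionSort.Properties ≥-decTotalOrder
  using (insert-↭; insert-↗; sort-↭; sort-↗)

-- The head of the result tells where `e` went: it is `e` if `e` was placed first, and otherwise an
-- entry not at most `e`, hence different from it.
insert-injective : ∀ e {xs ys} → insert e xs ≡ insert e ys → xs ≡ ys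
insert-injective e {xs} {ys} = go xs ys
  where
  ≰ᵇ⇒≢ : ∀ {y} → (y ≤ᵇ e) ≡ false → y ≢ e
  ≰ᵇ⇒≢ h refl = subst Bool.T h (≤⇒≤ᵇ {e} ≤-refl)

  go : ∀ xs ys → insert e xs ≡ insert e ys → xs ≡ ys
  go []       []       eq = refl
  go []       (y ∷ ys) eq with y ≤ᵇ e in h
  ... | true  = contradiction (∷-injectiveʳ eq) λ ()
  ... | false = contradiction (sym (∷-injectiveˡ eq)) (≰ᵇ⇒≢ h)
  go (x ∷ xs) []       eq with x ≤ᵇ e in h
  ... | true  = contradiction (∷-injectiveʳ eq) λ ()
  ... | false = contradiction (∷-injectiveˡ eq) (≰ᵇ⇒≢ h)
  go (x ∷ xs) (y ∷ ys) eq with x ≤ᵇ e in h | y ≤ᵇ e in h′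
  ... | true  | true  = ∷-injectiveʳ eq
  ... | true  | false = contradiction (sym (∷-injectiveˡ eq)) (≰ᵇ⇒≢ h′)
  ... | false | true  = contradiction (∷-injectiveˡ eq) (≰ᵇ⇒≢ h)
  ... | false | false = cong₂ _∷_ (∷-injectiveˡ eq) (go xs ys (∷-injectiveʳ eq))

-- `permute` makes this a condition on the multiset, so it can be carried across inserting or
-- removing a part at any position.
record Condition : Set₁ where
  field
    Holds  : List ℕ → Set
    holds? : Decidable Holds
    permute   : ∀ {xs ys} → xs ↭ ys → Holds xs → Holds ys

open Condition

infix 4 _⊨_
_⊨_ : List ℕ → Condition → Set
xs ⊨ P = Holds P xs

all : {Q : ℕ → Set} → Decidable Q → Condition
all {Q} Q? .Holds = All Q
all Q? .holds?    = All.all? Q?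
all Q? .permute      = All-resp-↭

infixr 6 _∧_
_∧_ : Condition → Condition → Condition
(P ∧ Q) .Holds xs              = xs ⊨ P × xs ⊨ Q
(P ∧ Q) .holds? xs             = holds? P xs ×-dec holds? Q xs
(P ∧ Q) .permute xs↭ys (p , q)    = permute P xs↭ys p , permute Q xs↭ys q

add : ℕ → Condition → Condition
add e P .Holds xs = e ∷ xs ⊨ P
add e P .holds?   = holds? P ∘ (e ∷_)
add e P .permute     = permute P ∘ prep e

avoid : ℕ → Condition
avoid e = all (λ x → ¬? (x ≟ e))

-- Generating functions of partitions under a condition.

count : {P : List ℕ → Set} → Decidable P → ℕ → ℕ
count P? n = length (filter P? (partitions n))

gf : Condition → Series
gf P n = + count (holds? P) n

unique-length : ∀ {A : Set} {xs ys : List A} → Unique xs → Unique ys →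
                (∀ {z} → z ∈ xs ⇔ z ∈ ys) → length xs ≡ length ys
unique-length u v eq = ↭-length (∼bag⇒↭ (unique∧set⇒bag u v eq))

∈-count : ∀ {P : List ℕ → Set} (P? : Decidable P) n {xs} →
          xs ∈ filter P? (partitions n) ⇔ (IsPartition n xs × P xs)
∈-count P? n {xs} = mk⇔
  (λ xs∈ → let xs∈′ , p = ∈-filter⁻ P? {xs = partitions n} xs∈ in to (∈-partitions n xs) xs∈′ , p)
  (λ (part , p) → ∈-filter⁺ P? (from (∈-partitions n xs) part) p)

count-unique : ∀ {P : List ℕ → Set} (P? : Decidable P) n → Unique (filter P? (partitions n))
count-unique P? n = Unique.filter⁺ P? (partitions-unique n)

count-cong : ∀ {P Q : List ℕ → Set} {P? : Decidable P} {Q? : Decidable Q} n →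
             (∀ {xs} → IsPartition n xs → P xs ⇔ Q xs) → count P? n ≡ count Q? n
count-cong {P? = P?} {Q?} n P⇔Q = unique-length (count-unique P? n) (count-unique Q? n) (mk⇔
  (λ xs∈ → let part , p = to (∈-count P? n) xs∈ in from (∈-count Q? n) (part , to (P⇔Q part) p))
  (λ xs∈ → let part , q = to (∈-count Q? n) xs∈ in from (∈-count P? n) (part , from (P⇔Q part) q)))

gf-cong : ∀ {P Q} → (∀ {xs} → xs ⊨ P ⇔ xs ⊨ Q) → gf P ≗ gf Q
gf-cong {P} {Q} P⇔Q n = cong +_ (count-cong {P? = holds? P} {holds? Q} n λ _ → P⇔Q)

filter-split : ∀ {A : Set} {P Q : A → Set} (P? : Decidable P) (Q? : Decidable Q) xs →
               length (filter P? xs) ≡ length (filter (λ x → P? x ×-dec ¬? (Q? x)) xs)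
                                     + length (filter (λ x → P? x ×-dec Q? x) xs)
filter-split P? Q? []       = refl
filter-split P? Q? (x ∷ xs) with P? x | Q? x
... | yes _ | yes _ = trans (cong suc (filter-split P? Q? xs)) (sym (+-suc _ _))
... | yes _ | no _  = cong suc (filter-split P? Q? xs)
... | no _  | yes _ = filter-split P? Q? xs
... | no _  | no _  = filter-split P? Q? xs

insert-partition : ∀ {e n xs} → 0 < e → IsPartition n xs → IsPartition (e + n) (insert e xs)
insert-partition {e} {n} {xs} 0<e (sorted , pos , refl) =
  insert-↗ e sorted ,
  All-resp-↭ (↭-sym (insert-↭ e xs)) (0<e ∷ pos) ,
  sum-↭ (insert-↭ e xs)

-- What is left after deleting `e` is sorted. Reinserting `e` gives a sorted permutation of `xs`,
-- and sorted permutations of each other are equal.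
remove-partition : ∀ {e n xs} → e ∈ xs → IsPartition (e + n) xs →
                   ∃[ ys ] IsPartition n ys × xs ≡ insert e ys
remove-partition {e} {n} {xs} e∈xs (sorted , pos , sum≡)
  with as , bs , refl ← ∈-∃++ e∈xs =
  ys , (sort-↗ (as ++ bs) , All.tail pos′ , +-cancelˡ-≡ e (sum ys) n (trans (sym (sum-↭ xs↭)) sum≡)) ,
  Pointwise-≡⇒≡ (↗↭↗⇒≋ (DecTotalOrder.totalOrder ≥-decTotalOrder) sorted (insert-↗ e (sort-↗ (as ++ bs)))
    (↭⇒↭ₛ (↭-trans xs↭ (↭-sym (insert-↭ e ys)))))
  where
  ys = sort (as ++ bs)
  xs↭ : as ++ e ∷ bs ↭ e ∷ ys
  xs↭ = ↭-trans (↭-shift e as bs) (prep e (↭-sym (sort-↭ (as ++ bs))))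
  pos′ : All (0 <_) (e ∷ ys)
  pos′ = All-resp-↭ xs↭ pos

∉⇔avoid : ∀ {e xs} → (¬ e ∈ xs) ⇔ (xs ⊨ avoid e)
∉⇔avoid = mk⇔ (All.map (λ e≢x x≡e → e≢x (sym x≡e)) ∘ ¬Any⇒All¬ _)
              (All¬⇒¬Any ∘ All.map (λ x≢e e≡x → x≢e (sym e≡x)))

-- A partition of n either avoids `e` or arises from exactly one partition of n - e by inserting
-- `e`.
gf-split : ∀ P {e} → 0 < e → gf P ≗ gf (P ∧ avoid e) ⊕ shift e (gf (add e P))
gf-split P {e} 0<e n with e ≤? n
... | no e≰n = begin
  gf P n                                              ≡⟨ cong +_ (count-cong {P? = holds? P} {holds? (P ∧ avoid e)} n avoids) ⟩
  gf (P ∧ avoid e) n                                  ≡⟨ ℤ.+-identityʳ _ ⟨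
  gf (P ∧ avoid e) n ℤ.+ 0ℤ                           ≡⟨ cong (λ z → gf (P ∧ avoid e) n ℤ.+ z) (shift-< e (gf (add e P)) (≰⇒> e≰n)) ⟨
  gf (P ∧ avoid e) n ℤ.+ shift e (gf (add e P)) n     ∎
  where
  open ≡-Reasoning
  avoids : ∀ {xs} → IsPartition n xs → xs ⊨ P ⇔ xs ⊨ P ∧ avoid e
  avoids {xs} (_ , _ , refl) = mk⇔
    (λ p → p , All.map (λ x≤n x≡e → e≰n (≤-trans (≤-reflexive (sym x≡e)) x≤n)) (parts≤sum xs))
    proj₁
... | yes e≤n with m , refl ← m≤n⇒∃[o]m+o≡n e≤n = begin
  + count (holds? P) (e + m)
    ≡⟨ cong +_ (filter-split (holds? P) (e ∈?_) (partitions (e + m))) ⟩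
  + (count (λ xs → holds? P xs ×-dec ¬? (e ∈? xs)) (e + m) + count with-e? (e + m))
    ≡⟨ cong₂ (λ a b → + (a + b))
         (count-cong {Q? = holds? (P ∧ avoid e)} (e + m) λ _ →
           mk⇔ (λ (p , e∉) → p , to ∉⇔avoid e∉) (λ (p , av) → p , from ∉⇔avoid av))
         removal ⟩
  gf (P ∧ avoid e) (e + m) ℤ.+ gf (add e P) m
    ≡⟨ cong (λ z → gf (P ∧ avoid e) (e + m) ℤ.+ z) (shift-at e (gf (add e P)) m) ⟨
  gf (P ∧ avoid e) (e + m) ℤ.+ shift e (gf (add e P)) (e + m)
    ∎
  where
  open ≡-Reasoning
  with-e? = λ xs → holds? P xs ×-dec (e ∈? xs)
  rest = filter (holds? (add e P)) (partitions m)

  members : ∀ {xs} → xs ∈ filter with-e? (partitions (e + m)) ⇔ xs ∈ map (insert e) rest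
  members {xs} = mk⇔ ⇒ ⇐
    where
    ⇒ : xs ∈ filter with-e? (partitions (e + m)) → xs ∈ map (insert e) rest
    ⇒ xs∈ with part , p , e∈xs ← to (∈-count with-e? (e + m)) xs∈
          with ys , part′ , refl ← remove-partition e∈xs part =
      ∈-map⁺ (insert e) (from (∈-count (holds? (add e P)) m) (part′ , permute P (insert-↭ e ys) p))
    ⇐ : xs ∈ map (insert e) rest → xs ∈ filter with-e? (partitions (e + m))
    ⇐ xs∈ with ys , ys∈ , refl ← ∈-map⁻ (insert e) xs∈
          with part , p ← to (∈-count (holds? (add e P)) m) ys∈ =
      from (∈-count with-e? (e + m)) (insert-partition 0<e part ,
        permute P (↭-sym (insert-↭ e ys)) p , ∈-resp-↭ (↭-sym (insert-↭ e ys)) (here refl))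

  removal : count with-e? (e + m) ≡ count (holds? (add e P)) m
  removal = trans
    (unique-length (count-unique with-e? (e + m))
      (Unique.map⁺ (insert-injective e) (count-unique (holds? (add e P)) m)) members)
    (length-map (insert e) rest)

-- If `e` can be added and dropped freely, `add e P` amounts to `P`, and `gf-split` turns the factor
-- 1 - X^e into the exclusion of `e`.
gf-Δ : ∀ P {e} → 0 < e → (∀ {xs} → e ∷ xs ⊨ P ⇔ xs ⊨ P) → Δ e (gf P) ≗ gf (P ∧ avoid e)
gf-Δ P {e} 0<e free n = begin
  gf P n ℤ.- shift e (gf P) n
    ≡⟨ cong₂ ℤ._-_ (gf-split P 0<e n) (φ-cong (shift-linear e) (gf-cong {P} {add e P} (mk⇔ (from free) (to free))) n) ⟩
  gf (P ∧ avoid e) n ℤ.+ shift e (gf (add e P)) n ℤ.- shift e (gf (add e P)) n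
    ≡⟨ //-rightDividesʳ (shift e (gf (add e P)) n) (gf (P ∧ avoid e) n) ⟩
  gf (P ∧ avoid e) n
    ∎
  where
  open ≡-Reasoning

all-cong : ∀ {Q R : ℕ → Set} → (∀ {x} → Q x ⇔ R x) → ∀ {xs} → All Q xs ⇔ All R xs
all-cong Q⇔R = mk⇔ (All.map (to Q⇔R)) (All.map (from Q⇔R))

-- Parity and halves.

⌊2*n/2⌋≡n : ∀ n → ⌊ 2 * n /2⌋ ≡ n
⌊2*n/2⌋≡n n = trans (cong (λ m → ⌊ n + m /2⌋) (+-identityʳ n)) (sym (n≡⌊n+n/2⌋ n))

⌊1+2*n/2⌋≡n : ∀ n → ⌊ suc (2 * n) /2⌋ ≡ n
⌊1+2*n/2⌋≡n zero = refl
⌊1+2*n/2⌋≡n (suc n) rewrite +-suc n (n + 0) = cong suc (⌊1+2*n/2⌋≡n n)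

2*-even : ∀ n → Even (2 * n)
2*-even n = m∣m*n n

1+2*-odd : ∀ n → Odd (suc (2 * n))
1+2*-odd n (divides q eq) = even≢odd q n (trans (*-comm 2 q) (sym eq))

even⇒≡ : ∀ {x} → Even x → x ≡ 2 * ⌊ x /2⌋
even⇒≡ (divides q refl) rewrite *-comm q 2 = cong (2 *_) (sym (⌊2*n/2⌋≡n q))

odd⇒≡ : ∀ {x} → Odd x → x ≡ suc (2 * ⌊ x /2⌋)
odd⇒≡ {zero}        odd = contradiction (2*-even 0) odd
odd⇒≡ {suc zero}    odd = refl
odd⇒≡ {suc (suc x)} odd = trans (cong (λ m → suc (suc m)) (odd⇒≡ λ { (divides q refl) → odd (divides (suc q) refl) }))
  (cong suc (sym (*-suc 2 ⌊ x /2⌋)))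

-- Its generating function ∏ 1/(1 - X^(2e)) is the series `p` shared by both sides.
evens : Condition
evens = all even?

-- The recurrence for C.

module CSeries (k′ i : ℕ) where

  private
    k = suc k′

  -- Exclusions are expressed through a = ⌊ x /2⌋ - i for an odd part x, and
  -- through ⌊ y /2⌋ for an even part y: then x excludes the even parts y with
  -- a < ⌊ y /2⌋ < a + k.
  Clear : ℕ → ℕ → Set
  Clear x y = Odd x →
      (Even y → ⌊ x /2⌋ < ⌊ y /2⌋ + i → ⌊ x /2⌋ + k ≤ ⌊ y /2⌋ + i)
    × (Odd y → ⌊ x /2⌋ ≤ ⌊ y /2⌋ → ⌊ x /2⌋ + k ≤ ⌊ y /2⌋)

  clear? : Decidable₂ Clear
  clear? x y = odd? x →-dec
    ((even? y →-dec (_ <? _ →-dec _ ≤? _)) ×-dec (odd? y →-dec (_ ≤? _ →-dec _ ≤? _)))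

  -- Symmetric, so that pairwise compatibility is independent of the order of the list and forms a
  -- `Condition`.
  Compatible : ℕ → ℕ → Set
  Compatible x y = Clear x y × Clear y x

  compatible : Condition
  compatible .Holds         = AllPairs Compatible
  compatible .holds?        = allPairs? (λ x y → clear? x y ×-dec clear? y x)
  compatible .permute xs↭ys = AllPairs-resp-↭ swap (resp₂ Compatible) (↭⇒↭ₛ xs↭ys)

  -- With a = ⌊ x /2⌋ - i this is 0 ≤ a and a + k ≤ M, written without subtraction.
  Bounded : ℕ → ℕ → Set
  Bounded M x = Odd x → i ≤ ⌊ x /2⌋ × ⌊ x /2⌋ + k ≤ M + i

  bounded? : ∀ M → Decidable (Bounded M)
  bounded? M x = odd? x →-dec (_ ≤? _ ×-dec _ ≤? _)

  upTo : ℕ → Condition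
  upTo M = compatible ∧ all (bounded? M)

  -- Forbids exactly the even parts 2e with a < e ≤ a + ℓ, those whose factors occur in `block a ℓ`.
  Beyond : ℕ → ℕ → ℕ → Set
  Beyond a ℓ y = Even y → a < ⌊ y /2⌋ → a + ℓ < ⌊ y /2⌋

  beyond? : ∀ a ℓ → Decidable (Beyond a ℓ)
  beyond? a ℓ y = even? y →-dec (_ <? _ →-dec _ <? _)

  V : ℕ → Series
  V M = gf (upTo M)

  open Recurrence 2 k′ (gf evens)

  -- An odd part would need an index a ≥ 0 with a + k ≤ M < k.
  V-initial : ∀ {M} → M ≤ k′ → V M ≗ gf evens
  V-initial {M} M≤k′ = gf-cong {upTo M} {evens} (mk⇔ (λ (_ , bs) → All.map even bs) ⇐)
    where
    even : ∀ {x} → Bounded M x → Even x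
    even {x} b = decidable-stable (even? x) λ odd →
      let i≤ , ≤M = b odd in
      <-irrefl refl (≤-trans (s≤s (+-monoˡ-≤ i M≤k′))
        (≤-trans (≤-reflexive (+-comm k i)) (≤-trans (+-monoˡ-≤ k i≤) ≤M)))

    ⇐ : ∀ {xs} → All Even xs → AllPairs Compatible xs × All (Bounded M) xs
    ⇐ []       = [] , []
    ⇐ (e ∷ es) with ps , bs ← ⇐ es =
      All.map (λ e′ → contradiction e , contradiction e′) es ∷ ps , contradiction e ∷ bs

  -- Under `upTo a` each odd part has an index at most a - k, so the even parts it excludes are less
  -- than 2a. The parts 2e with e > a can be added freely, and `gf-Δ` forbids them one at a time.
  V-block : ∀ a ℓ → gf (upTo a ∧ all (beyond? a ℓ)) ≗ block a ℓ (V a)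
  V-block a zero n = gf-cong {upTo a ∧ all (beyond? a 0)} {upTo a} (mk⇔ proj₁ (λ p → p , trivial _)) n
    where
    trivial : ∀ xs → All (Beyond a 0) xs
    trivial = All.universal λ y _ a< → ≤-trans (≤-reflexive (cong suc (+-identityʳ a))) a<
  V-block a (suc ℓ) n = begin
    gf (upTo a ∧ all (beyond? a (suc ℓ))) n
      ≡⟨ gf-cong {P ∧ avoid e} {upTo a ∧ all (beyond? a (suc ℓ))} (mk⇔
           (λ ((u , bs) , av) → u , All.zipWith extend (bs , av))
           (λ (u , bs) → (u , All.map weaken bs) , All.map differ bs)) n ⟨
    gf (P ∧ avoid e) n
      ≡⟨ gf-Δ P 0<e (mk⇔
           (λ { ((_ ∷ ps , _ ∷ bds) , _ ∷ bs) → (ps , bds) , bs })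
           (λ ((ps , bds) , bs) → (All.map e-compatible bds ∷ ps , (contradiction e-even ∷ bds)) , e-beyond ∷ bs)) n ⟨
    Δ e (gf P) n
      ≡⟨ φ-cong (Δ-linear e) (V-block a ℓ) n ⟩
    Δ e (block a ℓ (V a)) n
      ∎
    where
    open ≡-Reasoning
    P = upTo a ∧ all (beyond? a ℓ)
    e = 2 * (a + suc ℓ)

    0<e : 0 < e
    0<e = ≤-trans z<s (≤-trans (m≤n+m (suc ℓ) a) (m≤n*m (a + suc ℓ) 2))

    e-even : Even e
    e-even = 2*-even (a + suc ℓ)

    half : ⌊ e /2⌋ ≡ a + suc ℓ
    half = ⌊2*n/2⌋≡n (a + suc ℓ)

    e-beyond : Beyond a ℓ e
    e-beyond _ _ rewrite half = ≤-reflexive (sym (+-suc a ℓ))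

    e-compatible : ∀ {x} → Bounded a x → Compatible e x
    e-compatible {x} b .proj₁ odd = contradiction e-even odd
    e-compatible {x} b .proj₂ odd .proj₁ _ _ rewrite half =
      ≤-trans (proj₂ (b odd)) (+-monoˡ-≤ i (m≤m+n a (suc ℓ)))
    e-compatible {x} b .proj₂ odd .proj₂ odd-e = contradiction e-even odd-e

    extend : ∀ {y} → Beyond a ℓ y × y ≢ e → Beyond a (suc ℓ) y
    extend {y} (b , y≢e) even a< = ≤∧≢⇒< (≤-trans (≤-reflexive (+-suc a ℓ)) (b even a<))
      λ eq → y≢e (trans (even⇒≡ even) (cong (2 *_) (sym eq)))

    weaken : ∀ {y} → Beyond a (suc ℓ) y → Beyond a ℓ y
    weaken b even a< = ≤-trans (s≤s (+-monoʳ-≤ a (n≤1+n ℓ))) (b even a<)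

    differ : ∀ {y} → Beyond a (suc ℓ) y → y ≢ e
    differ b refl = <-irrefl (sym half) (b e-even
      (subst (a <_) (sym half) (m<m+n a z<s)))

  -- `e` is the only odd part allowed by the bound `suc a + k′` but not by `a + k′`. If it is
  -- present, the other odd parts have indices at most a - k, hence `upTo a`, and the even parts
  -- avoid its exclusions, hence `beyond? a k′`.
  V-recursive : ∀ a → V (suc a + k′) ≗ V (a + k′) ⊕ shift (suc (2 * i)) (step a (V a))
  V-recursive a n = begin
    V (suc a + k′) n
      ≡⟨ gf-split (upTo (suc a + k′)) {e} z<s n ⟩
    gf (upTo (suc a + k′) ∧ avoid e) n ℤ.+ shift e (gf (add e (upTo (suc a + k′)))) n
      ≡⟨ cong₂ ℤ._+_
           (gf-cong {upTo (suc a + k′) ∧ avoid e} {upTo (a + k′)} (mk⇔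
             (λ ((ps , bs) , av) → ps , All.zipWith tighten (bs , av))
             (λ (ps , bs) → (ps , All.map relax bs) , All.map differ bs)) n)
           (φ-cong (shift-linear e)
             (gf-cong {add e (upTo (suc a + k′))} {upTo a ∧ all (beyond? a k′)} (mk⇔ ⇒ ⇐)) n) ⟩
    V (a + k′) n ℤ.+ shift e (gf (upTo a ∧ all (beyond? a k′))) n
      ≡⟨ cong (λ z → V (a + k′) n ℤ.+ z) (φ-cong (shift-linear e) (V-block a k′) n) ⟩
    V (a + k′) n ℤ.+ shift e (block a k′ (V a)) n
      -- The weight 2(a + i) + 1 splits into w = 2i + 1 and the exponent 2a that `step a` supplies.
      ≡⟨ cong (λ m → V (a + k′) n ℤ.+ shift m (block a k′ (V a)) n) (weight a i) ⟩
    V (a + k′) n ℤ.+ shift (suc (2 * i) + 2 * a) (block a k′ (V a)) n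
      ≡⟨ cong (λ f → V (a + k′) n ℤ.+ f n) (shift-+ (suc (2 * i)) (2 * a) (block a k′ (V a))) ⟨
    V (a + k′) n ℤ.+ shift (suc (2 * i)) (step a (V a)) n
      ∎
    where
    open ≡-Reasoning
    e = suc (2 * (a + i))

    weight : ∀ a i → suc (2 * (a + i)) ≡ suc (2 * i) + 2 * a
    weight = ℕ-Ring.solve-∀

    half : ⌊ e /2⌋ ≡ a + i
    half = ⌊1+2*n/2⌋≡n (a + i)

    e-odd : Odd e
    e-odd = 1+2*-odd (a + i)

    split : ∀ a j i → suc a + j + i ≡ a + i + suc j
    split = ℕ-Ring.solve-∀

    bound : suc a + k′ + i ≡ a + i + k
    bound = split a k′ i

    relax : ∀ {x} → Bounded (a + k′) x → Bounded (suc a + k′) x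
    relax b odd = map₂ m≤n⇒m≤1+n (b odd)

    differ : ∀ {x} → Bounded (a + k′) x → x ≢ e
    differ b refl = <-irrefl refl (≤-trans (≤-reflexive bound)
      (subst (λ h → h + k ≤ a + k′ + i) half (proj₂ (b e-odd))))

    tighten : ∀ {x} → Bounded (suc a + k′) x × x ≢ e → Bounded (a + k′) x
    tighten {x} (b , x≢e) odd with i≤ , ≤M ← b odd = i≤ , ≤-pred (≤∧≢⇒< ≤M λ eq →
      x≢e (trans (odd⇒≡ odd) (cong (λ m → suc (2 * m)) (+-cancelʳ-≡ k _ _ (trans eq bound)))))

    ⇒ : ∀ {xs} → e ∷ xs ⊨ upTo (suc a + k′) → xs ⊨ upTo a ∧ all (beyond? a k′)
    ⇒ (c ∷ ps , _ ∷ bs) = (ps , All.zipWith lower (c , bs)) , All.map gap c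
      where
      -- The bound gives ⌊ x /2⌋ ≤ ⌊ e /2⌋, so the odd exclusions of `x` apply to `e`. Equality is
      -- included, which rules out a second copy of `e`.
      lower : ∀ {x} → Compatible e x × Bounded (suc a + k′) x → Bounded a x
      lower {x} ((_ , c) , b) odd with i≤ , ≤M ← b odd = i≤ ,
        subst (⌊ x /2⌋ + k ≤_) half (proj₂ (c odd) e-odd
          (subst (⌊ x /2⌋ ≤_) (sym half) (+-cancelʳ-≤ k _ _ (≤-trans ≤M (≤-reflexive bound)))))

      gap : ∀ {y} → Compatible e y → Beyond a k′ y
      gap {y} (c , _) even a< = +-cancelʳ-≤ i _ _ (≤-trans (≤-reflexive bound)
        (subst (λ h → h + k ≤ ⌊ y /2⌋ + i) half
          (proj₁ (c e-odd) even (subst (_< ⌊ y /2⌋ + i) (sym half) (+-monoˡ-< i a<)))))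

    ⇐ : ∀ {xs} → xs ⊨ upTo a ∧ all (beyond? a k′) → e ∷ xs ⊨ upTo (suc a + k′)
    ⇐ ((ps , bs) , gs) = All.zipWith compat (bs , gs) ∷ ps , e-bounded ∷ All.map raise bs
      where
      e-bounded : Bounded (suc a + k′) e
      e-bounded _ rewrite half = m≤n+m i a , ≤-reflexive (sym bound)

      raise : ∀ {x} → Bounded a x → Bounded (suc a + k′) x
      raise b odd = map₂ (λ ≤a → ≤-trans ≤a (+-monoˡ-≤ i (≤-trans (n≤1+n a) (m≤m+n (suc a) k′)))) (b odd)

      compat : ∀ {x} → Bounded a x × Beyond a k′ x → Compatible e x
      compat {x} (b , g) .proj₁ _ .proj₁ even e< rewrite half =
        ≤-trans (≤-reflexive (sym bound)) (+-monoˡ-≤ i (g even (+-cancelʳ-< i _ _ e<)))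
      -- The odd parts excluded by `e` start at `e` itself, above every other odd part.
      compat {x} (b , g) .proj₁ _ .proj₂ odd e≤ rewrite half =
        contradiction (≤-trans (m<m+n ⌊ x /2⌋ z<s) (proj₂ (b odd))) (≤⇒≯ e≤)
      compat {x} (b , g) .proj₂ odd .proj₁ even-e = contradiction even-e e-odd
      compat {x} (b , g) .proj₂ odd .proj₂ _ _ rewrite half = proj₂ (b odd)

  solution : Solution (suc (2 * i)) V
  solution = record { initial = V-initial ; recursive = V-recursive }

  -- The excluded even parts are 2(j + 1 + t - i) with t < k - 1, so for them ⌊ y /2⌋ + i runs from
  -- j + 1 to j + k - 1. Truncated subtraction is exact because i ≤ j.
  allowed⇔clear : ∀ {x y} j → x ≡ 2 * j + 1 → i ≤ j → Allowed k i j y ⇔ Clear x y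
  allowed⇔clear {x} {y} j refl i≤j = mk⇔ ⇒ ⇐
    where
    half : ⌊ 2 * j + 1 /2⌋ ≡ j
    half = trans (cong ⌊_/2⌋ (+-comm (2 * j) 1)) (⌊1+2*n/2⌋≡n j)

    odd : Odd (2 * j + 1)
    odd = subst Odd (+-comm 1 (2 * j)) (1+2*-odd j)

    even-entry : ∀ t → 2 * j + 2 + 2 * t ∸ 2 * i ≡ 2 * (suc (j + t) ∸ i)
    even-entry t = trans (cong (_∸ 2 * i) (double j t)) (sym (*-distribˡ-∸ 2 (suc (j + t)) i))
      where
      double : ∀ j t → 2 * j + 2 + 2 * t ≡ 2 * suc (j + t)
      double = ℕ-Ring.solve-∀

    odd-entry : ∀ t → 2 * j + 1 + 2 * t ≡ suc (2 * (j + t))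
    odd-entry = double j
      where
      double : ∀ j t → 2 * j + 1 + 2 * t ≡ suc (2 * (j + t))
      double = ℕ-Ring.solve-∀

    ⇒ : Allowed k i j y → Clear (2 * j + 1) y
    ⇒ (even∉ , odd∉) _ rewrite half = even-case , odd-case
      where
      even-case : Even y → j < ⌊ y /2⌋ + i → j + k ≤ ⌊ y /2⌋ + i
      -- The `t` with j + 1 + t = ⌊ y /2⌋ + i is the position of `y` in the excluded list if it is
      -- less than k - 1.
      even-case even j< with t , eq ← m≤n⇒∃[o]m+o≡n j< = ≮⇒≥ λ <k →
        even∉ even (subst (_∈ evenExcluded k i j)
          (trans (even-entry t) (trans (cong (λ m → 2 * (m ∸ i)) eq)
            (trans (cong (2 *_) (m+n∸n≡m ⌊ y /2⌋ i)) (sym (even⇒≡ even)))))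
          (∈-applyUpTo⁺ (λ t → 2 * j + 2 + 2 * t ∸ 2 * i) (≤-pred (+-cancelˡ-< j _ _ (subst (_< j + k) (trans (sym eq) (sym (+-suc j t))) <k)))))

      odd-case : Odd y → j ≤ ⌊ y /2⌋ → j + k ≤ ⌊ y /2⌋
      odd-case odd j≤ with t , eq ← m≤n⇒∃[o]m+o≡n j≤ = ≮⇒≥ λ <k →
        odd∉ odd (subst (_∈ oddExcluded k j)
          (trans (odd-entry t) (trans (cong (λ m → suc (2 * m)) eq) (sym (odd⇒≡ odd))))
          (∈-applyUpTo⁺ (λ t → 2 * j + 1 + 2 * t) (+-cancelˡ-< j _ _ (subst (_< j + k) (sym eq) <k))))

    ⇐ : Clear (2 * j + 1) y → Allowed k i j y
    ⇐ clear .proj₁ even y∈ with t , t<k′ , refl ← ∈-applyUpTo⁻ (λ t → 2 * j + 2 + 2 * t ∸ 2 * i) y∈ =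
      <⇒≱ t<k′ (≤-pred (+-cancelˡ-≤ j _ _ (≤-trans
        (subst₂ (λ a b → a + k ≤ b) half y-half (proj₁ (clear odd) even
          (subst₂ _<_ (sym half) (sym y-half) (s≤s (m≤m+n j t)))))
        (≤-reflexive (sym (+-suc j t))))))
      where
      y-half : ⌊ 2 * j + 2 + 2 * t ∸ 2 * i /2⌋ + i ≡ suc (j + t)
      y-half = trans (cong (λ m → ⌊ m /2⌋ + i) (even-entry t))
        (trans (cong (_+ i) (⌊2*n/2⌋≡n (suc (j + t) ∸ i)))
          (m∸n+n≡m (≤-trans i≤j (m≤n⇒m≤1+n (m≤m+n j t)))))
    ⇐ clear .proj₂ y-odd y∈ with t , t<k , refl ← ∈-applyUpTo⁻ (λ t → 2 * j + 1 + 2 * t) y∈ =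
      <⇒≱ t<k (+-cancelˡ-≤ j _ _ (subst₂ (λ a b → a + k ≤ b) half y-half
        (proj₂ (clear odd) y-odd (subst₂ _≤_ (sym half) (sym y-half) (m≤m+n j t)))))
      where
      y-half : ⌊ 2 * j + 1 + 2 * t /2⌋ ≡ j + t
      y-half = trans (cong ⌊_/2⌋ (odd-entry t)) (⌊1+2*n/2⌋≡n (j + t))

  Above : ℕ → Set
  Above x = Odd x → 2 * i + 1 ≤ x

  above⇒≤half : ∀ {x} → Above x → Odd x → i ≤ ⌊ x /2⌋
  above⇒≤half above odd = *-cancelˡ-≤ 2 (≤-pred
    (subst₂ _≤_ (+-comm (2 * i) 1) (odd⇒≡ odd) (above odd)))

  ≤half⇒above : ∀ {x} → (Odd x → i ≤ ⌊ x /2⌋) → Above x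
  ≤half⇒above i≤ odd = subst₂ _≤_ (+-comm 1 (2 * i)) (sym (odd⇒≡ odd)) (s≤s (*-monoʳ-≤ 2 (i≤ odd)))

  clear⇔ : ∀ {x y} → Above x → Clear x y ⇔ (∀ j → x ≡ 2 * j + 1 → Allowed k i j y)
  clear⇔ {x} {y} above = mk⇔
    (λ clear j eq → from (allowed⇔clear j eq (i≤j j eq)) clear)
    (λ allowed odd → to (allowed⇔clear ⌊ x /2⌋ (eq odd) (above⇒≤half above odd))
      (allowed ⌊ x /2⌋ (eq odd)) odd)
    where
    eq : Odd x → x ≡ 2 * ⌊ x /2⌋ + 1
    eq odd = trans (odd⇒≡ odd) (+-comm 1 _)
    i≤j : ∀ j → x ≡ 2 * j + 1 → i ≤ j
    i≤j j x≡ = subst (i ≤_) half (above⇒≤half above odd)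
      where
      x≡′ : x ≡ suc (2 * j)
      x≡′ = trans x≡ (+-comm (2 * j) 1)
      odd : Odd x
      odd = subst Odd (sym x≡′) (1+2*-odd j)
      half : ⌊ x /2⌋ ≡ j
      half = trans (cong ⌊_/2⌋ x≡′) (⌊1+2*n/2⌋≡n j)

  Removals : List ℕ → Set
  Removals xs = ∀ (p : Fin (length xs)) (j : ℕ) → lookup xs p ≡ 2 * j + 1 →
                All (Allowed k i j) (removeAt xs p)

  -- Removing position p compares that entry with all others, so each pair of positions is tested
  -- once from each side.
  removals⇔compatible : ∀ {xs} → All Above xs → Removals xs ⇔ AllPairs Compatible xs
  removals⇔compatible as = mk⇔ (⇒ as) (⇐ as)
    where
    ⇒ : ∀ {xs} → All Above xs → Removals xs → AllPairs Compatible xs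
    ⇒ []       f = []
    ⇒ {x ∷ xs} (a ∷ as) f = All.tabulate compat ∷ ⇒ as λ p j eq → All.tail (f (Fin.suc p) j eq)
      where
      compat : ∀ {y} → y ∈ xs → Compatible x y
      compat y∈ =
        from (clear⇔ a) (λ j eq → All.lookup (f Fin.zero j eq) y∈) ,
        from (clear⇔ (All.lookup as y∈)) (λ j eq →
          All.head (f (Fin.suc (Any.index y∈)) j (trans (sym (lookup-index y∈)) eq)))

    ⇐ : ∀ {xs} → All Above xs → AllPairs Compatible xs → Removals xs
    ⇐ (a ∷ as) (c ∷ cs) Fin.zero j eq = All.map (λ (c , _) → to (clear⇔ a) c j eq) c
    ⇐ {x ∷ xs} (a ∷ as) (c ∷ cs) (Fin.suc p) j eq =
      to (clear⇔ (All.lookup as (∈-lookup p))) (proj₂ (All.lookup c (∈-lookup p))) j eq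
        ∷ ⇐ as cs p j eq

  -- A part of a partition of n has ⌊ x /2⌋ ≤ n, so for M ≥ n + k the upper bound in `upTo M` holds
  -- automatically.
  C-count : ∀ n M → n + k ≤ M → + C k i n ≡ V M n
  C-count n M n+k≤M = cong +_ (count-cong {P? = cPartition? k i} {holds? (upTo M)} n equiv)
    where
    equiv : ∀ {xs} → IsPartition n xs → CPartition k i xs ⇔ xs ⊨ upTo M
    equiv {xs} (_ , _ , refl) = mk⇔
      (λ (f , as) → to (removals⇔compatible as) f , All.zipWith bounded (as , parts≤sum xs))
      (λ (ps , bs) → let as = All.map (λ {x} b → ≤half⇒above {x} (proj₁ ∘ b)) bs in
        from (removals⇔compatible as) ps , as)
      where
      bounded : ∀ {x} → Above x × x ≤ sum xs → Bounded M x
      bounded {x} (a , x≤n) odd = above⇒≤half a odd ,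
        ≤-trans (+-monoˡ-≤ k (≤-trans (⌊n/2⌋≤n x) x≤n)) (≤-trans n+k≤M (m≤m+n M i))

-- Residues modulo 4k and the recurrence for B.

mod⇔ : ∀ {x r N} → r < N → x ≡ r [mod N ] ⇔ (∃[ q ] x ≡ r + N * q)
mod⇔ {x} {r} {N} r<N = mk⇔ ⇒ ⇐
  where
  ⇒ : x ≡ r [mod N ] → ∃[ q ] x ≡ r + N * q
  ⇒ N∣ with r ≤? x
  ... | yes r≤x with divides q eq ← N∣ = q , (begin
    x               ≡⟨ m+[n∸m]≡n r≤x ⟨
    r + (x ∸ r)     ≡⟨ cong (λ z → r + z) (trans (sym (m≤n⇒∣n-m∣≡n∸m r≤x)) (trans eq (*-comm q N))) ⟩
    r + N * q       ∎)
    where open ≡-Reasoning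
  -- For x < r the distance r - x is positive and less than N, so N cannot divide it.
  ... | no r≰x = contradiction (subst (N ∣_) (m≤n⇒∣m-n∣≡n∸m (<⇒≤ (≰⇒> r≰x))) N∣)
    (>⇒∤ {{>-nonZero (m<n⇒0<n∸m (≰⇒> r≰x))}} (≤-<-trans (m∸n≤m r x) r<N))

  ⇐ : (∃[ q ] x ≡ r + N * q) → x ≡ r [mod N ]
  ⇐ (q , refl) = subst (N ∣_)
    (sym (trans (m≤n⇒∣n-m∣≡n∸m (m≤m+n r (N * q))) (m+n∸m≡n r (N * q)))) (m∣m*n q)

module BSeries (k′ i : ℕ) (i<k : i < suc k′) where

  private
    k = suc k′

  -- The residues 2i + 1 and 2k + 2i + 1 modulo 4k together form the progression 2i + 1 modulo 2k;
  -- the doubles of its terms are the numbers 4i + 2 modulo 4k.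
  mark : ℕ → ℕ
  mark s = suc (2 * i) + 2 * k * s

  mark≡ : ∀ s → mark s ≡ suc (2 * (i + k * s))
  mark≡ s = double i k s
    where
    double : ∀ i k s → suc (2 * i) + 2 * k * s ≡ suc (2 * (i + k * s))
    double = ℕ-Ring.solve-∀

  mark-odd : ∀ s → Odd (mark s)
  mark-odd s = subst Odd (sym (mark≡ s)) (1+2*-odd (i + k * s))

  mark-injective : ∀ {s t} → mark s ≡ mark t → s ≡ t
  mark-injective {s} {t} eq = *-cancelˡ-≡ s t (2 * k) (+-cancelˡ-≡ (suc (2 * i)) _ _ eq)

  s≤mark : ∀ s → s ≤ mark s
  s≤mark s = ≤-trans (m≤n*m s (2 * k)) (m≤n+m (2 * k * s) (suc (2 * i)))

  marks doubles : ℕ → List ℕ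
  marks   = applyDownFrom mark
  doubles = applyDownFrom (λ s → 2 * mark s)

  ∈-marks⁻ : ∀ {x t} → x ∈ marks t → ∃[ s ] s < t × x ≡ mark s
  ∈-marks⁻ = ∈-applyDownFrom⁻ mark

  ∈-doubles⁻ : ∀ {x t} → x ∈ doubles t → ∃[ s ] s < t × x ≡ 2 * mark s
  ∈-doubles⁻ = ∈-applyDownFrom⁻ (λ s → 2 * mark s)

  -- Interpolates between all even parts at t = 0 and `BPart` in the limit: each step admits one
  -- mark and forbids its double.
  Stage : ℕ → ℕ → Set
  Stage t x = (Even x × x ∉ doubles t) ⊎ x ∈ marks t

  stage? : ∀ t → Decidable (Stage t)
  stage? t x = (even? x ×-dec (x ∉? doubles t)) ⊎-dec (x ∈? marks t)

  V : ℕ → Series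
  V t = gf (all (stage? t))

  gf-all-Δ : ∀ {Q : ℕ → Set} (Q? : Decidable Q) {e} → 0 < e → Q e →
             Δ e (gf (all Q?)) ≗ gf (all Q? ∧ avoid e)
  gf-all-Δ Q? 0<e q = gf-Δ (all Q?) 0<e (mk⇔ All.tail (q ∷_))

  -- (1 - X^m) V (t+1) = (1 - X^2m) V t, where m = mark t: both sides count the
  -- partitions at stage t without the part 2m.
  V-step : ∀ t → V (suc t) ≗ V t ⊕ shift (mark t) (V t)
  V-step t n = Δ-cancel {V (suc t)} {V t ⊕ shift m (V t)} m agree n ≤-refl
    where
    m = mark t

    2m-stage : Stage t (2 * m)
    2m-stage = inj₁ (2*-even m , λ 2m∈ → let s , s<t , eq = ∈-doubles⁻ 2m∈ in
      <-irrefl (mark-injective (sym (*-cancelˡ-≡ m (mark s) 2 eq))) s<t)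

    ⇒ : ∀ {x} → Stage (suc t) x × x ≢ m → Stage t x × x ≢ 2 * m
    ⇒ (inj₁ (even , x∉) , _)      = inj₁ (even , x∉ ∘ there) , x∉ ∘ here
    ⇒ (inj₂ (here x≡m) , x≢m)     = contradiction x≡m x≢m
    ⇒ (inj₂ (there x∈) , _) with s , _ , refl ← ∈-marks⁻ {t = t} x∈ =
      inj₂ x∈ , λ eq → mark-odd s (subst Even (sym eq) (2*-even m))

    ⇐ : ∀ {x} → Stage t x × x ≢ 2 * m → Stage (suc t) x × x ≢ m
    ⇐ (inj₁ (even , x∉) , x≢2m) =
      inj₁ (even , λ { (here eq) → x≢2m eq ; (there x∈) → x∉ x∈ }) , λ { refl → mark-odd t even }
    ⇐ (inj₂ x∈ , _) = inj₂ (there x∈) , λ x≡m → let s , s<t , eq = ∈-marks⁻ x∈ in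
      <-irrefl (mark-injective (trans (sym eq) x≡m)) s<t

    agree : Δ m (V (suc t)) ≈⟨ n ⟩ Δ m (V t ⊕ shift m (V t))
    agree l _ = begin
      Δ m (V (suc t)) l
        ≡⟨ gf-all-Δ (stage? (suc t)) z<s (inj₂ (here refl)) l ⟩
      gf (all (stage? (suc t)) ∧ avoid m) l
        ≡⟨ gf-cong {all (stage? (suc t)) ∧ avoid m} {all (stage? t) ∧ avoid (2 * m)} (mk⇔
             (All.unzip ∘ All.map ⇒ ∘ All.zip) (All.unzip ∘ All.map ⇐ ∘ All.zip)) l ⟩
      gf (all (stage? t) ∧ avoid (2 * m)) l
        ≡⟨ gf-all-Δ (stage? t) z<s 2m-stage l ⟨
      V t l ℤ.- shift (2 * m) (V t) l
        ≡⟨ cong (λ e → V t l ℤ.- shift (m + e) (V t) l) (+-identityʳ m) ⟩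
      V t l ℤ.- shift (m + m) (V t) l
        ≡⟨ cong (λ f → V t l ℤ.- f l) (shift-+ m m (V t)) ⟨
      V t l ℤ.- shift m (shift m (V t)) l
        ≡⟨ factor (V t l) (shift m (V t) l) (shift m (shift m (V t)) l) ⟩
      V t l ℤ.+ shift m (V t) l ℤ.- (shift m (V t) l ℤ.+ shift m (shift m (V t)) l)
        ≡⟨ cong (λ z → V t l ℤ.+ shift m (V t) l ℤ.- z)
             (φ-⊕ (shift-linear m) (V t) (shift m (V t)) l) ⟨
      Δ m (V t ⊕ shift m (V t)) l
        ∎
      where
      open ≡-Reasoning
      factor : ∀ x y z → x ℤ.- z ≡ x ℤ.+ y ℤ.- (y ℤ.+ z)
      factor = ℤ-Ring.solve-∀

  open Recurrence (2 * k) 0 (gf evens)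

  -- Here Q = X^(2k) and the gap is 1, so the block is empty and `step a` multiplies by X^(2ka).
  -- With w = 2i + 1 the total exponent is `mark a`.
  solution : Solution (suc (2 * i)) V
  solution .Solution.initial z≤n = gf-cong {all (stage? 0)} {evens}
    (all-cong (mk⇔ (λ { (inj₁ (even , _)) → even ; (inj₂ ()) }) (λ even → inj₁ (even , λ ()))))
  solution .Solution.recursive a n rewrite +-identityʳ a =
    trans (V-step a n) (cong (λ f → V a n ℤ.+ f n) (sym (shift-+ (suc (2 * i)) (2 * k * a) (V a))))

  4i+2<4k : 4 * i + 2 < 4 * k
  4i+2<4k = ≤-trans (≤-trans (n≤1+n _) (≤-reflexive (solve i))) (*-monoʳ-≤ 4 i<k)
    where
    solve : ∀ i → suc (suc (4 * i + 2)) ≡ 4 * suc i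
    solve = ℕ-Ring.solve-∀

  2k+2i+1<4k : 2 * k + 2 * i + 1 < 4 * k
  2k+2i+1<4k = ≤-trans (≤-reflexive (solve k i))
    (≤-trans (+-monoʳ-≤ (2 * k) (*-monoʳ-≤ 2 i<k)) (≤-reflexive (double k)))
    where
    solve : ∀ k i → suc (2 * k + 2 * i + 1) ≡ 2 * k + 2 * suc i
    solve = ℕ-Ring.solve-∀
    double : ∀ k → 2 * k + 2 * k ≡ 4 * k
    double = ℕ-Ring.solve-∀

  2i+1<4k : 2 * i + 1 < 4 * k
  2i+1<4k = ≤-<-trans (+-monoˡ-≤ 1 (m≤n+m (2 * i) (2 * k))) 2k+2i+1<4k

  double-mark : ∀ s → 4 * i + 2 + 4 * k * s ≡ 2 * mark s
  double-mark s = solve i k s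
    where
    solve : ∀ i k s → 4 * i + 2 + 4 * k * s ≡ 2 * (suc (2 * i) + 2 * k * s)
    solve = ℕ-Ring.solve-∀

  even-mark : ∀ q → 2 * i + 1 + 4 * k * q ≡ mark (2 * q)
  even-mark q = solve i k q
    where
    solve : ∀ i k q → 2 * i + 1 + 4 * k * q ≡ suc (2 * i) + 2 * k * (2 * q)
    solve = ℕ-Ring.solve-∀

  odd-mark : ∀ q → 2 * k + 2 * i + 1 + 4 * k * q ≡ mark (suc (2 * q))
  odd-mark q = solve i k q
    where
    solve : ∀ i k q → 2 * k + 2 * i + 1 + 4 * k * q ≡ suc (2 * i) + 2 * k * suc (2 * q)
    solve = ℕ-Ring.solve-∀

  -- Since s ≤ `mark s`, a mark or double equal to x < t has s < t, so stage t already decides `x`.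
  -- Even s gives the residue 2i + 1, odd s the residue 2k + 2i + 1.
  bPart⇔stage : ∀ {t x} → x < t → BPart k i x ⇔ Stage t x
  bPart⇔stage {t} {x} x<t = mk⇔ ⇒ ⇐
    where
    mark∈ : ∀ s → x ≡ mark s → x ∈ marks t
    mark∈ s refl = ∈-applyDownFrom⁺ mark (≤-<-trans (s≤mark s) x<t)

    ⇒ : BPart k i x → Stage t x
    ⇒ (inj₁ (even , ≢)) = inj₁ (even , λ x∈ → let s , _ , eq = ∈-doubles⁻ x∈ in
      ≢ (from (mod⇔ 4i+2<4k) (s , trans eq (sym (double-mark s)))))
    ⇒ (inj₂ (_ , inj₁ ≡₁)) with q , eq ← to (mod⇔ 2i+1<4k) ≡₁ =
      inj₂ (mark∈ (2 * q) (trans eq (even-mark q)))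
    ⇒ (inj₂ (_ , inj₂ ≡₂)) with q , eq ← to (mod⇔ 2k+2i+1<4k) ≡₂ =
      inj₂ (mark∈ (suc (2 * q)) (trans eq (odd-mark q)))

    ⇐ : Stage t x → BPart k i x
    ⇐ (inj₁ (even , x∉)) = inj₁ (even , λ ≡mod → x∉ (double∈ (to (mod⇔ 4i+2<4k) ≡mod)))
      where
      double∈ : (∃[ s ] x ≡ 4 * i + 2 + 4 * k * s) → x ∈ doubles t
      double∈ (s , eq) = subst (_∈ doubles t) (sym eq′) (∈-applyDownFrom⁺ (λ s → 2 * mark s)
        (≤-<-trans (≤-trans (s≤mark s) (≤-trans (m≤n*m (mark s) 2) (≤-reflexive (sym eq′)))) x<t))
        where
        eq′ : x ≡ 2 * mark s
        eq′ = trans eq (double-mark s)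
    ⇐ (inj₂ x∈) with s , _ , refl ← ∈-marks⁻ x∈ = inj₂ (mark-odd s , residue)
      where
      residue : mark s ≡ 2 * i + 1 [mod 4 * k ] ⊎ mark s ≡ 2 * k + 2 * i + 1 [mod 4 * k ]
      residue with even? s
      ... | yes even = inj₁ (from (mod⇔ 2i+1<4k)
              (⌊ s /2⌋ , trans (cong mark (even⇒≡ even)) (sym (even-mark ⌊ s /2⌋))))
      ... | no odd = inj₂ (from (mod⇔ 2k+2i+1<4k)
              (⌊ s /2⌋ , trans (cong mark (odd⇒≡ odd)) (sym (odd-mark ⌊ s /2⌋))))

  B-count : ∀ n t → n < t → + B k i n ≡ V t n
  B-count n t n<t = cong +_ (count-cong {P? = All.all? (bPart? k i)} {holds? (all (stage? t))} n equiv)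
    where
    equiv : ∀ {xs} → IsPartition n xs → All (BPart k i) xs ⇔ All (Stage t) xs
    equiv {xs} (_ , _ , refl) = mk⇔
      (λ ps → All.zipWith (λ (x≤n , p) → to (bPart⇔stage (≤-<-trans x≤n n<t)) p) (parts≤sum xs , ps))
      (λ ss → All.zipWith (λ (x≤n , s) → from (bPart⇔stage (≤-<-trans x≤n n<t)) s) (parts≤sum xs , ss))

-- Both counts as coefficients of the common limit.

corollary8 : ∀ (k i : ℕ) → 2 ≤ k → i < k → ∀ (n : ℕ) → B k i n ≡ C k i n
corollary8 k@(suc k′) i 2≤k i<k n = ℤ.+-injective (begin
  + B k i n
    ≡⟨ BSeries.B-count k′ i i<k n M₁ (s≤s (m≤m+n n (n * 1))) ⟩
  BSeries.V k′ i i<k M₁ n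
    -- The product ck agrees: (2k)·1 for B and 2·k for C.
    ≡⟨ limit-unique (*-identityʳ (2 * k)) (BSeries.solution k′ i i<k) (CSeries.solution k′ i)
         {n} {M₁} {M₂} (n≤1+n _) (m≤m+n _ k) ⟩
  CSeries.V k′ i M₂ n
    ≡⟨ CSeries.C-count k′ i n M₂ (+-monoˡ-≤ k (m≤m+n n (n * k))) ⟨
  + C k i n
    ∎)
  where
  open ≡-Reasoning
  -- `M₁` exceeds n and `M₂` is at least n + k, as the two counts require; they also reach the
  -- bounds n + n * 1 and n + n * k of `limit-unique`.
  M₁ = suc (n + n * 1)
  M₂ = n + n * k + k
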